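{- (Automorphism Splitting Theorem) Let $\Gamma$ be a connected finite simple graph with first Betti number $b_1\geq 2$ such that $\mathcal{H}^0(F(\Gamma))$ is trivial. Then \[\mathrm{Aut}(\Gamma)\cong\ker(\phi^1_\Gamma)\times\mathcal{H}^1(\Gamma),\] where the elements of $\ker(\phi^1_\Gamma)$ correspond to the automorphisms of $\Gamma$ that fix $\mathrm{Cyc}(\Gamma)$ pointwise, and the elements of $\mathcal{H}^1(\Gamma)$ correspond to the automorphisms of $\Gamma$ that fix $F(\Gamma)$ pointwise.
   Context: $b_1$ is the number of independent cycles. Cycle-forest decomposition: let $F_1$ be the set of leaves (degree-1 vertices) of $\Gamma$, and recursively let $F_j$ be the set of leaves of $\Gamma-\bigcup_{i<j}F_i$ (removing vertices with their incident edges), until $F_j=\emptyset$ for all $j>k$. $F(\Gamma)$ is the subgraph consisting of the vertices of $\bigcup_{i=1}^kF_i$ together with all edges of $\Gamma$ incident to them (and their endpoints); $\mathrm{Cyc}(\Gamma)=\Gamma-\bigcup_{i=1}^kF_i$. For a graph $X$: $H^0(X)$ is the space of real vertex functions constant on connected components, $\Omega^1(X)$ the space of real functions $f$ on ordered pairs of adjacent vertices with $f(v,w)=-f(w,v)$, $D$ maps a vertex function $u$ to $Du(v,w)=u(w)-u(v)$, and $H^1(X)=\Omega^1(X)/\mathrm{Im}(D)$. Each $g\in\mathrm{Aut}(X)$ acts on $H^0(X)$ and $H^1(X)$ by pullback ($g^*u(v)=u(g(v))$, $g^*f(v,w)=f(g(v),g(w))$); $\phi^i_X(g)=(g^*)^{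 -1}$ on $H^i(X)$, and $\mathcal{H}^i(X)$ is the image of $\phi^i_X$, $i=0,1$.
   Formalization: The vertex functions in H^0 and the edge functions in Ω^1 (hence H^1, the actions and Im(D)) take rational values instead of real values. -}

module Defs where

open import Data.Nat using (ℕ; zero; suc; _+_; _∸_; _≡ᵇ_; _<ᵇ_)
open import Data.Fin using (Fin; zero; suc; toℕ)
open import Data.Bool using (Bool; true; false; if_then_else_; _∧_; _∨_; not)
open import Data.Rational using (ℚ; _-_; -_)
open import Data.Product using (Σ; ∃; _×_; _,_; proj₁)
open import Data.Fin.Permutation using (Permutation′; _⟨$⟩ʳ_; _⟨$⟩ˡ_)
open import Function using (_∘_)
open import Relation.Binary.PropositionalEquality using (_≡_)

record Graph (n : ℕ) : Set where
  field
    adj    : Fin n → Fin n → Bool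
    sym    : ∀ i j → adj i j ≡ adj j i
    irrefl : ∀ i → adj i i ≡ false
open Graph public

countTrue : ∀ {n} → (Fin n → Bool) → ℕ
countTrue {zero}  p = 0
countTrue {suc n} p = (if p zero then 1 else 0) + countTrue (p ∘ suc)

sumFin : ∀ {n} → (Fin n → ℕ) → ℕ
sumFin {zero}  f = 0
sumFin {suc n} f = f zero + sumFin (f ∘ suc)

edgeCount : ∀ {n} → Graph n → ℕ
edgeCount G = sumFin (λ i → countTrue (λ j → adj G i j ∧ (toℕ i <ᵇ toℕ j)))

data Walk {n} (G : Graph n) : Fin n → Fin n → Set where
  here : ∀ {v} → Walk G v v
  step : ∀ {u v w} → adj G u v ≡ true → Walk G v w → Walk G u w

Connected : ∀ {n} → Graph n → Set
Connected G = ∀ u v → Walk G u v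

-- first Betti number (cycle rank) |E| - |V| + 1 of a connected graph
betti1 : ∀ {n} → Graph n → ℕ
betti1 {n} G = (edgeCount G + 1) ∸ n

degRem : ∀ {n} → Graph n → (Fin n → Bool) → Fin n → ℕ
degRem G R v = countTrue (λ w → adj G v w ∧ not (R w))

leafRem : ∀ {n} → Graph n → (Fin n → Bool) → Fin n → Bool
leafRem G R v = not (R v) ∧ (degRem G R v ≡ᵇ 1)

removedUpTo : ∀ {n} → Graph n → ℕ → Fin n → Bool
removedUpTo G zero    v = false
removedUpTo G (suc k) v =
  removedUpTo G k v ∨ leafRem G (removedUpTo G k) v

-- ⋃_i F_i  (at most n peeling steps can be nonempty)
forestCore : ∀ {n} → Graph n → Fin n → Bool
forestCore {n} G = removedUpTo G n

anyFin : ∀ {n} → (Fin n → Bool) → Bool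
anyFin p = not (countTrue p ≡ᵇ 0)

inF : ∀ {n} → Graph n → Fin n → Bool
inF G v = forestCore G v ∨ anyFin (λ w → adj G v w ∧ forestCore G w)

edgeF : ∀ {n} → Graph n → Fin n → Fin n → Bool
edgeF G v w = adj G v w ∧ (forestCore G v ∨ forestCore G w)

inCyc : ∀ {n} → Graph n → Fin n → Bool
inCyc G v = not (forestCore G v)

IsAut : ∀ {n} → Graph n → Permutation′ n → Set
IsAut G σ = ∀ i j → adj G (σ ⟨$⟩ʳ i) (σ ⟨$⟩ʳ j) ≡ adj G i j

Aut : ∀ {n} → Graph n → Set
Aut {n} G = Σ (Permutation′ n) (IsAut G)

⟦_⟧ : ∀ {n} {P : Permutation′ n → Set} → Σ (Permutation′ n) P → Fin n → Fin n
⟦ g ⟧ = proj₁ g ⟨$⟩ʳ_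

⟦_⟧⁻¹ : ∀ {n} {P : Permutation′ n → Set} → Σ (Permutation′ n) P → Fin n → Fin n
⟦ g ⟧⁻¹ = proj₁ g ⟨$⟩ˡ_

-- automorphisms of the subgraph F(Γ), represented as permutations of Fin n
-- that are the identity off the vertex set of F(Γ), preserve it, and
-- preserve the edge relation of F(Γ) on it
IsAutF : ∀ {n} → Graph n → Permutation′ n → Set
IsAutF G σ =
    (∀ v → inF G v ≡ false → σ ⟨$⟩ʳ v ≡ v)
  × (∀ v → inF G (σ ⟨$⟩ʳ v) ≡ inF G v)
  × (∀ v w → inF G v ≡ true → inF G w ≡ true →
       edgeF G (σ ⟨$⟩ʳ v) (σ ⟨$⟩ʳ w) ≡ edgeF G v w)

-- real (here: rational) vertex functions of F(Γ) constant on its components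
IsH0F : ∀ {n} → Graph n → (Fin n → ℚ) → Set
IsH0F G u = ∀ v w → edgeF G v w ≡ true → u v ≡ u w

-- φ⁰(σ) = (σ*)⁻¹ = (σ⁻¹)*
φ0 : ∀ {n} → Permutation′ n → (Fin n → ℚ) → (Fin n → ℚ)
φ0 σ u v = u (σ ⟨$⟩ˡ v)

H0F-trivial : ∀ {n} → Graph n → Set
H0F-trivial {n} G = ∀ (σ : Permutation′ n) → IsAutF G σ →
  ∀ u → IsH0F G u → ∀ v → inF G v ≡ true → φ0 σ u v ≡ u v

Ω1 : ∀ {n} → Graph n → Set
Ω1 {n} G = Σ (Fin n → Fin n → ℚ) λ f →
  ∀ v w → adj G v w ≡ true → f v w ≡ - f w v

-- equality in H¹(Γ) = Ω¹(Γ)/Im(D)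
Cohom : ∀ {n} → Graph n → (Fin n → Fin n → ℚ) → (Fin n → Fin n → ℚ) → Set
Cohom {n} G f f' = ∃ λ (u : Fin n → ℚ) →
  ∀ v w → adj G v w ≡ true → f v w - f' v w ≡ u w - u v

-- φ¹(g) = (g*)⁻¹ = (g⁻¹)*, on representatives
φ1 : ∀ {n} {G : Graph n} → Aut G → (Fin n → Fin n → ℚ) → (Fin n → Fin n → ℚ)
φ1 g f v w = f (⟦ g ⟧⁻¹ v) (⟦ g ⟧⁻¹ w)

Sameφ1 : ∀ {n} (G : Graph n) → Aut G → Aut G → Set
Sameφ1 G g h = ∀ (f : Ω1 G) → Cohom G (φ1 {G = G} g (proj₁ f)) (φ1 {G = G} h (proj₁ f))

InKerφ1 : ∀ {n} (G : Graph n) → Aut G → Set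
InKerφ1 G g = ∀ (f : Ω1 G) → Cohom G (φ1 {G = G} g (proj₁ f)) (proj₁ f)

FixesCyc : ∀ {n} (G : Graph n) → Aut G → Set
FixesCyc G g = ∀ v → inCyc G v ≡ true → ⟦ g ⟧ v ≡ v

FixesF : ∀ {n} (G : Graph n) → Aut G → Set
FixesF G g = ∀ v → inF G v ≡ true → ⟦ g ⟧ v ≡ v

_≈A_ : ∀ {n} {P : Permutation′ n → Set} → Σ (Permutation′ n) P → Σ (Permutation′ n) P → Set
g ≈A h = ∀ v → ⟦ g ⟧ v ≡ ⟦ h ⟧ v

-- The conclusion of the Automorphism Splitting Theorem:
-- Aut(Γ) ≅ ker(φ¹) × 𝓗¹(Γ), realised as the internal direct product
-- Aut(Γ) = K · L with K = {g fixing Cyc(Γ) pointwise} = ker(φ¹) and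
-- L = {g fixing F(Γ) pointwise}, on which φ¹ restricts to an isomorphism onto 𝓗¹(Γ).
record AutSplitting {n} (G : Graph n) : Set where
  field
    ker-iff-fixCyc : ∀ (g : Aut G) → (InKerφ1 G g → FixesCyc G g) × (FixesCyc G g → InKerφ1 G g)
    φ1-inj-on-L : ∀ (l l' : Aut G) → FixesF G l → FixesF G l' → Sameφ1 G l l' → l ≈A l'
    φ1-onto-on-L : ∀ (g : Aut G) → ∃ λ (l : Aut G) → FixesF G l × Sameφ1 G l g
    K-L-commute : ∀ (k l : Aut G) → FixesCyc G k → FixesF G l →
      ∀ v → ⟦ k ⟧ (⟦ l ⟧ v) ≡ ⟦ l ⟧ (⟦ k ⟧ v)
    decompose : ∀ (g : Aut G) → ∃ λ (k : Aut G) → ∃ λ (l : Aut G) →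
      FixesCyc G k × FixesF G l × (∀ v → ⟦ g ⟧ v ≡ ⟦ k ⟧ (⟦ l ⟧ v))
    decompose-unique : ∀ (k l k' l' : Aut G) →
      FixesCyc G k → FixesF G l → FixesCyc G k' → FixesF G l' →
      (∀ v → ⟦ k ⟧ (⟦ l ⟧ v) ≡ ⟦ k' ⟧ (⟦ l' ⟧ v)) → (k ≈A k') × (l ≈A l')

{-# OPTIONS --safe #-}
module Submission where

-- Functions can be prescribed on Cyc(Γ) and propagated over the forest, so H¹(Γ) only sees
-- Cyc(Γ), and an automorphism fixing Cyc(Γ) pointwise acts trivially. The converse is a Lefschetz
-- count. Let g act trivially on H¹, and for an edge xy write g·[xy] − [xy] = D c_xy, where [xy] is
-- its elementary 1-form. Evaluating Σ_v Σ_{w ~ v} c_vw(v) once edge by edge and once vertex by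
-- vertex shows that the core has at most as many unoriented edges moved by g as moved vertices.
-- As its degrees are at least 2, counting incidences then forbids edges between moved and fixed
-- vertices, so all of the connected core is moved or all of it is fixed; the former contradicts
-- |E| > |V| in the core, a form of b₁ ≥ 2 that survives the removal of leaves.
--
-- For the splitting, sending a vertex of F(Γ) to the core vertex its tree is attached to is
-- constant on components, so triviality on H⁰(F(Γ)) makes every automorphism fix these attachment
-- vertices; hence its restrictions to the forest and to Cyc(Γ) both extend by the identity.

open import Defs
open import Data.Nat using (ℕ; _≥_)
open import Algebra.Bundles using (CommutativeRing)
open import Data.Bool using (Bool; true; false; if_then_else_; _∧_; _∨_; not; T)
import Data.Bool.Properties as Bool
open import Data.Bool.Properties using (∧-comm; ∧-conicalˡ; ∧-conicalʳ; ∧-identityʳ; ∨-conicalˡ; ∨-conicalʳ; ∨-identityʳ; ∨-zeroʳ)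
open import Data.Fin using (Fin; zero; suc; toℕ)
open import Data.Fin.Permutation using (Permutation′; permutation; flip; _∘ₚ_; _⟨$⟩ʳ_; _⟨$⟩ˡ_; inverseˡ; inverseʳ)
open import Data.Fin.Properties using (_≟_; any?; toℕ-injective)
import Data.Nat as ℕ
import Data.Nat.Properties as ℕ
import Data.Product as P
open import Data.Product using (∃; _,_; map; proj₁; proj₂)
open import Data.Rational using (ℚ; 0ℚ; 1ℚ; ½; _+_; _*_; _-_; -_; _≤_; _<_; +-0-rawMonoid)
import Data.Rational.Properties as ℚ
open import Data.Rational.Solver using (module +-*-Solver)
open import Data.Sum using (_⊎_; inj₁; inj₂)
open import Data.Unit using (tt)
open import Function using (_∘_)
open import Relation.Binary.Construct.Closure.ReflexiveTransitive using (Star; ε; _◅_)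
import Relation.Binary.PropositionalEquality as ≡
open ≡ using (_≡_; _≢_; refl; cong; cong₂; trans; subst; subst₂)
open import Relation.Nullary using (does; yes; no; ¬_; contradiction)
open import Algebra.Properties.Semiring.Sum (CommutativeRing.semiring ℚ.+-*-commutativeRing)
import Algebra.Properties.CommutativeMonoid.Sum ℕ.+-0-commutativeMonoid as Sumℕ
open import Algebra.Definitions.RawMonoid +-0-rawMonoid using (_×_)
open import Algebra.Properties.Monoid.Mult ℚ.+-0-monoid using (×-homo-+)
open +-*-Solver using (solve; _:=_; _:+_; _:*_; _:-_; :-_; con)

private
  variable
    n : ℕ

-- Finite sums of rationals

≤⇒≯ : ∀ {x y} → x ≤ y → ¬ y < x
≤⇒≯ x≤y y<x = ℚ.<-irrefl refl (ℚ.<-≤-trans y<x x≤y)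

ind : Bool → ℚ
ind b = if b then 1ℚ else 0ℚ

ind-≥0 : ∀ b → 0ℚ ≤ ind b
ind-≥0 true  = ℚ.nonNegative⁻¹ 1ℚ
ind-≥0 false = ℚ.≤-refl

ind*-≥0 : ∀ b {x} → 0ℚ ≤ x → 0ℚ ≤ ind b * x
ind*-≥0 true  {x} x≥0 = subst (0ℚ ≤_) (≡.sym (ℚ.*-identityˡ x)) x≥0
ind*-≥0 false {x} x≥0 = ℚ.≤-reflexive (≡.sym (ℚ.*-zeroˡ x))

sum-mono-≤ : {f g : Fin n → ℚ} → (∀ i → f i ≤ g i) → sum f ≤ sum g
sum-mono-≤ {ℕ.zero}  f≤g = ℚ.≤-refl
sum-mono-≤ {ℕ.suc n} f≤g = ℚ.+-mono-≤ (f≤g zero) (sum-mono-≤ (f≤g ∘ suc))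

sum-zero : {f : Fin n → ℚ} → (∀ i → f i ≡ 0ℚ) → sum f ≡ 0ℚ
sum-zero {n = n} f≡0 = trans (sum-cong-≗ f≡0) (sum-replicate-zero n)

sum-≥0 : {f : Fin n → ℚ} → (∀ i → 0ℚ ≤ f i) → 0ℚ ≤ sum f
sum-≥0 {n = n} {f} f≥0 = subst (_≤ sum f) (sum-replicate-zero n) (sum-mono-≤ f≥0)

term≤sum : {f : Fin n → ℚ} → (∀ i → 0ℚ ≤ f i) → ∀ i → f i ≤ sum f
term≤sum {f = f} f≥0 zero    = subst (_≤ sum f) (ℚ.+-identityʳ (f zero))
  (ℚ.+-monoʳ-≤ (f zero) (sum-≥0 (f≥0 ∘ suc)))
term≤sum {f = f} f≥0 (suc i) = subst (_≤ sum f) (ℚ.+-identityˡ (f (suc i)))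
  (ℚ.+-mono-≤ (f≥0 zero) (term≤sum (f≥0 ∘ suc) i))

∑-distrib-- : (f g : Fin n → ℚ) → ∑[ i < n ] (f i - g i) ≡ sum f - sum g
∑-distrib-- {ℕ.zero}  f g = refl
∑-distrib-- {ℕ.suc n} f g = trans (cong (f zero - g zero +_) (∑-distrib-- (f ∘ suc) (g ∘ suc)))
  (solve 4 (λ a b c d → a :- b :+ (c :- d) := (a :+ c) :- (b :+ d)) refl
    (f zero) (g zero) (sum (f ∘ suc)) (sum (g ∘ suc)))

δ : Fin n → Fin n → ℚ
δ i j = ind (does (i ≟ j))

δ-refl : (i : Fin n) → δ i i ≡ 1ℚ
δ-refl i with i ≟ i
... | yes _  = refl
... | no i≢i = contradiction refl i≢i

δ-≢ : {i j : Fin n} → i ≢ j → δ i j ≡ 0ℚ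
δ-≢ {i = i} {j} i≢j with i ≟ j
... | yes i≡j = contradiction i≡j i≢j
... | no  _   = refl

∑-δ : (h : Fin n → ℚ) (a : Fin n) → ∑[ w < n ] (δ w a * h w) ≡ h a
∑-δ h zero    = trans (cong₂ _+_ (ℚ.*-identityˡ (h zero)) (sum-zero λ i → ℚ.*-zeroˡ (h (suc i))))
  (ℚ.+-identityʳ (h zero))
∑-δ h (suc a) = trans (cong₂ _+_ (ℚ.*-zeroˡ (h zero)) (∑-δ (h ∘ suc) a)) (ℚ.+-identityˡ (h (suc a)))

∑∑-cong : {f g : Fin n → Fin n → ℚ} → (∀ i j → f i j ≡ g i j) →
  ∑[ i < n ] ∑[ j < n ] f i j ≡ ∑[ i < n ] ∑[ j < n ] g i j
∑∑-cong f≡g = sum-cong-≗ λ i → sum-cong-≗ (f≡g i)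

∑∑-distrib-+ : (f g : Fin n → Fin n → ℚ) → ∑[ i < n ] ∑[ j < n ] (f i j + g i j) ≡
  ∑[ i < n ] ∑[ j < n ] f i j + ∑[ i < n ] ∑[ j < n ] g i j
∑∑-distrib-+ f g = trans (sum-cong-≗ λ i → ∑-distrib-+ (f i) (g i)) (∑-distrib-+ (sum ∘ f) (sum ∘ g))

∑∑-symmetrise : (f : Fin n → Fin n → ℚ) → ∑[ i < n ] ∑[ j < n ] f i j + ∑[ i < n ] ∑[ j < n ] f i j ≡
  ∑[ i < n ] ∑[ j < n ] (f i j + f j i)
∑∑-symmetrise f = trans (cong (sum (sum ∘ f) +_) (∑-comm f)) (≡.sym (∑∑-distrib-+ f λ i j → f j i))

x+x≡0⇒x≡0 : ∀ {x} → x + x ≡ 0ℚ → x ≡ 0ℚ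
x+x≡0⇒x≡0 {x} x+x≡0 = trans (solve 1 (λ x → x := con ½ :* (x :+ x)) refl x) (cong (½ *_) x+x≡0)

∑∑-antisym : (f : Fin n → Fin n → ℚ) → (∀ i j → f i j + f j i ≡ 0ℚ) → ∑[ i < n ] ∑[ j < n ] f i j ≡ 0ℚ
∑∑-antisym f anti = x+x≡0⇒x≡0 (trans (∑∑-symmetrise f) (sum-zero λ i → sum-zero (anti i)))

-- The Lefschetz count on the core

edgeForm : Fin n → Fin n → Fin n → Fin n → ℚ
edgeForm x y v w = δ x v * δ y w - δ y v * δ x w

-- `E` and `κ` stand for the adjacency and the vertex set of the core, and `γ` for the inverse of
-- `g`, along which `φ1` pulls back. The functions `c x y` witness that pulling `edgeForm x y` back
-- along `γ` changes it only by a coboundary on the core.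
module Lefschetz
  (E : Fin n → Fin n → Bool) (E-sym : ∀ v w → E v w ≡ E w v) (E-irrefl : ∀ v → E v v ≡ false)
  (κ : Fin n → Bool) (E⇒κ : ∀ v w → E v w ≡ true → κ v ≡ true)
  (connected : ∀ v w → κ v ≡ true → κ w ≡ true → Star (λ v w → E v w ≡ true) v w)
  (γ : Fin n → Fin n) (γ-E : ∀ v w → E (γ v) (γ w) ≡ E v w) (γ-κ : ∀ v → κ (γ v) ≡ κ v)
  (c : Fin n → Fin n → Fin n → ℚ) (c-anti : ∀ x y v → c y x v ≡ - c x y v)
  (c-D : ∀ x y v w → E v w ≡ true → c x y w - c x y v ≡ edgeForm x y (γ v) (γ w) - edgeForm x y v w)
  where

  private
    b : Fin n → Fin n → ℚ
    b v w = ind (E v w)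

    b-sym : ∀ v w → b v w ≡ b w v
    b-sym v w = cong ind (E-sym v w)

    -- A potential for the change of the star of `x`, the sum of the elementary forms leaving `x`.
    -- Its diagonal gives the evaluation of `S` vertex by vertex.
    m : Fin n → Fin n → ℚ
    m x v = ∑[ w < n ] (b x w * c x w v)

  moved : Fin n → ℚ
  moved v = 1ℚ - δ v (γ v)

  -- The star of `x` is minus the differential of the indicator of `x`: at an edge `v w` only the
  -- terms `y = w` and `y = v` survive.
  div-edgeForm : ∀ x v w → E v w ≡ true → ∑[ y < n ] (b x y * edgeForm x y v w) ≡ δ x v - δ x w
  div-edgeForm x v w Evw = begin
    ∑[ y < n ] (b x y * edgeForm x y v w)
      ≡⟨ sum-cong-≗ (λ y → solve 5 (λ b p q r s → b :* (p :* q :- r :* s) := q :* (b :* p) :- r :* (b :* s))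
           refl (b x y) (δ x v) (δ y w) (δ y v) (δ x w)) ⟩
    ∑[ y < n ] (δ y w * (b x y * δ x v) - δ y v * (b x y * δ x w))
      ≡⟨ ∑-distrib-- (λ y → δ y w * (b x y * δ x v)) (λ y → δ y v * (b x y * δ x w)) ⟩
    ∑[ y < n ] (δ y w * (b x y * δ x v)) - ∑[ y < n ] (δ y v * (b x y * δ x w))
      ≡⟨ cong₂ _-_ (∑-δ (λ y → b x y * δ x v) w) (∑-δ (λ y → b x y * δ x w) v) ⟩
    b x w * δ x v - b x v * δ x w
      ≡⟨ cong₂ _-_ (absorb x v w Evw) (absorb x w v (trans (E-sym w v) Evw)) ⟩
    δ x v - δ x w ∎
    where
    open ≡.≡-Reasoning
    absorb : ∀ x v w → E v w ≡ true → b x w * δ x v ≡ δ x v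
    absorb x v w Evw with x ≟ v
    ... | yes refl rewrite Evw = refl
    ... | no  _    = ℚ.*-zeroʳ (b x w)

  m-D : ∀ x v w → E v w ≡ true → m x w - m x v ≡ (δ x (γ v) - δ x (γ w)) - (δ x v - δ x w)
  m-D x v w Evw = begin
    m x w - m x v
      ≡⟨ ∑-distrib-- (λ y → b x y * c x y w) (λ y → b x y * c x y v) ⟨
    ∑[ y < n ] (b x y * c x y w - b x y * c x y v)
      ≡⟨ sum-cong-≗ (λ y → trans
           (solve 3 (λ b p q → b :* p :- b :* q := b :* (p :- q)) refl (b x y) (c x y w) (c x y v))
           (trans (cong (b x y *_) (c-D x y v w Evw))
             (solve 3 (λ b p q → b :* (p :- q) := b :* p :- b :* q) refl
               (b x y) (edgeForm x y (γ v) (γ w)) (edgeForm x y v w)))) ⟩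
    ∑[ y < n ] (b x y * edgeForm x y (γ v) (γ w) - b x y * edgeForm x y v w)
      ≡⟨ ∑-distrib-- (λ y → b x y * edgeForm x y (γ v) (γ w)) (λ y → b x y * edgeForm x y v w) ⟩
    ∑[ y < n ] (b x y * edgeForm x y (γ v) (γ w)) - ∑[ y < n ] (b x y * edgeForm x y v w)
      ≡⟨ cong₂ _-_ (div-edgeForm x (γ v) (γ w) (trans (γ-E v w) Evw)) (div-edgeForm x v w Evw) ⟩
    (δ x (γ v) - δ x (γ w)) - (δ x v - δ x w) ∎
    where open ≡.≡-Reasoning

  -- By `m-D`, `m x` has the same differential as the function `δ x v - δ x (γ v)` of `v`; along a
  -- walk the two can therefore differ only by a constant.
  m-walk : ∀ x {v w} → Star (λ v w → E v w ≡ true) v w →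
    m x v ≡ m x w + ((δ x v - δ x (γ v)) - (δ x w - δ x (γ w)))
  m-walk x {v} ε = solve 2 (λ m d → m := m :+ (d :- d)) refl (m x v) (δ x v - δ x (γ v))
  m-walk x {v} {w} (_◅_ {j = t} Evt p) = begin
    m x v
      ≡⟨ solve 2 (λ a b → a := b :- (b :- a)) refl (m x v) (m x t) ⟩
    m x t - (m x t - m x v)
      ≡⟨ cong₂ _-_ (m-walk x p) (m-D x v t Evt) ⟩
    m x w + ((δ x t - δ x (γ t)) - (δ x w - δ x (γ w))) - ((δ x (γ v) - δ x (γ t)) - (δ x v - δ x t))
      ≡⟨ solve 6 (λ m t t' d v v' → m :+ ((t :- t') :- d) :- ((v' :- t') :- (v :- t)) := m :+ ((v :- v') :- d))
           refl (m x w) (δ x t) (δ x (γ t)) (δ x w - δ x (γ w)) (δ x v) (δ x (γ v)) ⟩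
    m x w + ((δ x v - δ x (γ v)) - (δ x w - δ x (γ w))) ∎
    where open ≡.≡-Reasoning

  -- Inside the core this is `m-walk` from `x` to the base point `r`. Off the core `x` has no
  -- `E`-edges and both values of `m` vanish; the factors `ind (κ x)` make one formula cover both
  -- cases, so that it can be summed over all `x`.
  m-diagonal : ∀ r → κ r ≡ true → ∀ x →
    m x x ≡ m x r + (ind (κ x) * moved x - (δ x r * ind (κ x) - δ x (γ r) * ind (κ x)))
  m-diagonal r κr x with κ x in κx
  ... | true = trans (m-walk x (connected x r κx κr)) (trans
          (cong (λ z → m x r + ((z - δ x (γ x)) - (δ x r - δ x (γ r)))) (δ-refl x))
          (solve 4 (λ m g d e → m :+ ((con 1ℚ :- g) :- (d :- e)) :=
              m :+ (con 1ℚ :* (con 1ℚ :- g) :- (d :* con 1ℚ :- e :* con 1ℚ)))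
            refl (m x r) (δ x (γ x)) (δ x r) (δ x (γ r))))
  ... | false = trans (m≡0 x) (trans (cong (_+ 0ℚ) (≡.sym (m≡0 r)))
          (solve 4 (λ m g d e → m :+ con 0ℚ :=
              m :+ (con 0ℚ :* g :- (d :* con 0ℚ :- e :* con 0ℚ)))
            refl (m x r) (moved x) (δ x r) (δ x (γ r))))
    where
    m≡0 : ∀ v → m x v ≡ 0ℚ
    m≡0 v = sum-zero vanish
      where
      vanish : ∀ w → b x w * c x w v ≡ 0ℚ
      vanish w with E x w in Exw
      ... | true  = contradiction (trans (≡.sym κx) (E⇒κ x w Exw)) λ ()
      ... | false = ℚ.*-zeroˡ (c x w v)

  S : ℚ
  S = ∑[ v < n ] ∑[ w < n ] (b v w * c v w v)

  -- The values at `r` sum to zero because `c` is antisymmetric in its edge. The two `δ` terms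
  -- contribute `ind (κ r)` and `ind (κ (γ r))`, which cancel, so `S` is the number of moved core
  -- vertices.
  S-vertices : ∀ r → κ r ≡ true → S ≡ ∑[ v < n ] (ind (κ v) * moved v)
  S-vertices r κr = begin
    ∑[ x < n ] m x x
      ≡⟨ sum-cong-≗ (m-diagonal r κr) ⟩
    ∑[ x < n ] (m x r + (U x - (P x - Q x)))
      ≡⟨ ∑-distrib-+ (λ x → m x r) (λ x → U x - (P x - Q x)) ⟩
    ∑[ x < n ] m x r + ∑[ x < n ] (U x - (P x - Q x))
      ≡⟨ cong₂ _+_ (∑∑-antisym (λ x w → b x w * c x w r) anti)
           (trans (∑-distrib-- U (λ x → P x - Q x)) (cong (_-_ (sum U)) (∑-distrib-- P Q))) ⟩
    0ℚ + (sum U - (sum P - sum Q))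
      ≡⟨ cong₂ (λ p q → 0ℚ + (sum U - (p - q))) (∑-δ (ind ∘ κ) r)
           (trans (∑-δ (ind ∘ κ) (γ r)) (cong ind (γ-κ r))) ⟩
    0ℚ + (sum U - (ind (κ r) - ind (κ r)))
      ≡⟨ solve 2 (λ u k → con 0ℚ :+ (u :- (k :- k)) := u) refl (sum U) (ind (κ r)) ⟩
    sum U ∎
    where
    open ≡.≡-Reasoning
    U P Q : Fin n → ℚ
    U x = ind (κ x) * moved x
    P x = δ x r * ind (κ x)
    Q x = δ x (γ r) * ind (κ x)
    anti : ∀ x w → b x w * c x w r + b w x * c w x r ≡ 0ℚ
    anti x w rewrite b-sym w x | c-anti x w r =
      solve 2 (λ b c → b :* c :+ b :* (:- c) := con 0ℚ) refl (b x w) (c x w r)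

  -- Both orientations of an edge together contribute `c v w v - c v w w`, which `c-D` evaluates to
  -- 1, minus 1 if both ends are fixed, plus 1 if the edge is reversed. Hence `S + S` bounds the
  -- number of oriented edges with a moved end.
  S-edges : ∑[ v < n ] ∑[ w < n ] (b v w * (1ℚ - δ v (γ v) * δ w (γ w))) ≤ S + S
  S-edges = subst (∑[ v < n ] ∑[ w < n ] (b v w * (1ℚ - δ v (γ v) * δ w (γ w))) ≤_)
    (≡.sym (∑∑-symmetrise λ v w → b v w * c v w v)) (sum-mono-≤ λ v → sum-mono-≤ λ w → bound v w)
    where
    open ℚ.≤-Reasoning
    bound : ∀ v w → b v w * (1ℚ - δ v (γ v) * δ w (γ w)) ≤ b v w * c v w v + b w v * c w v w
    bound v w rewrite E-sym w v | c-anti v w w with E v w in Evw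
    ... | false = ℚ.≤-reflexive (solve 3 (λ z p q → con 0ℚ :* z := con 0ℚ :* p :+ con 0ℚ :* (:- q)) refl
                    (1ℚ - δ v (γ v) * δ w (γ w)) (c v w v) (c v w w))
    ... | true = begin
      1ℚ * (1ℚ - f)
        ≡⟨ solve 1 (λ f → con 1ℚ :* (con 1ℚ :- f) := (con 1ℚ :- f) :+ con 0ℚ) refl f ⟩
      (1ℚ - f) + 0ℚ
        -- `g` is the indicator that `γ` swaps the two ends; discarding it is the only loss in the
        -- estimate.
        ≤⟨ ℚ.+-monoʳ-≤ (1ℚ - f) (ind*-≥0 (does (w ≟ γ v)) (ind-≥0 (does (v ≟ γ w)))) ⟩
      (1ℚ - f) + g
        ≡⟨ solve 2 (λ f g → (con 1ℚ :- f) :+ g := :- ((f :- g) :- (con 1ℚ :* con 1ℚ :- con 0ℚ :* con 0ℚ))) refl f g ⟩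
      - ((f - g) - (1ℚ * 1ℚ - 0ℚ * 0ℚ))
        ≡⟨ cong₂ (λ p q → - ((f - g) - (p - q))) (cong₂ _*_ (δ-refl v) (δ-refl w))
             (cong₂ _*_ (δ-≢ (v≢w ∘ ≡.sym)) (δ-≢ v≢w)) ⟨
      - ((f - g) - edgeForm v w v w)
        ≡⟨ cong -_ (c-D v w v w Evw) ⟨
      - (c v w w - c v w v)
        ≡⟨ solve 2 (λ p q → :- (q :- p) := con 1ℚ :* p :+ con 1ℚ :* (:- q)) refl (c v w v) (c v w w) ⟩
      1ℚ * c v w v + 1ℚ * - c v w w ∎
      where
      f g : ℚ
      f = δ v (γ v) * δ w (γ w)
      g = δ w (γ v) * δ v (γ w)
      v≢w : v ≢ w
      v≢w refl = contradiction (trans (≡.sym Evw) (E-irrefl v)) λ ()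

  module _
    (r : Fin n) (κr : κ r ≡ true)
    (min-degree : ∀ v → κ v ≡ true → 1ℚ + 1ℚ ≤ ∑[ w < n ] b v w)
    (excess : ∑[ v < n ] ind (κ v) + ∑[ v < n ] ind (κ v) < ∑[ v < n ] ∑[ w < n ] b v w)
    where

    private
      U : Fin n → ℚ
      U v = ind (κ v) * moved v

    edges≤2U : ∑[ v < n ] ∑[ w < n ] (b v w * (1ℚ - δ v (γ v) * δ w (γ w))) ≤ sum U + sum U
    edges≤2U = subst (λ s → ∑[ v < n ] ∑[ w < n ] (b v w * (1ℚ - δ v (γ v) * δ w (γ w))) ≤ s + s)
      (S-vertices r κr) S-edges

    -- The right side weights each moved core vertex by its degree, which is at least 2.
    2U≤incidences : sum U + sum U ≤ ∑[ v < n ] ∑[ w < n ] (b v w * U w)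
    2U≤incidences = begin
      sum U + sum U
        ≡⟨ ∑-distrib-+ U U ⟨
      ∑[ w < n ] (U w + U w)
        ≤⟨ sum-mono-≤ bound ⟩
      ∑[ w < n ] (U w * ∑[ v < n ] b w v)
        ≡⟨ sum-cong-≗ (λ w → trans (*-distribˡ-sum (U w) (b w))
             (sum-cong-≗ λ v → trans (ℚ.*-comm (U w) (b w v)) (cong (_* U w) (b-sym w v)))) ⟩
      ∑[ w < n ] ∑[ v < n ] (b v w * U w)
        ≡⟨ ∑-comm (λ v w → b v w * U w) ⟨
      ∑[ v < n ] ∑[ w < n ] (b v w * U w) ∎
      where
      open ℚ.≤-Reasoning
      bound : ∀ w → U w + U w ≤ U w * ∑[ v < n ] b w v
      bound w with κ w in κw
      ... | false = ℚ.≤-reflexive (solve 2 (λ x d → con 0ℚ :* x :+ con 0ℚ :* x := con 0ℚ :* x :* d) refl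
                      (moved w) (∑[ v < n ] b w v))
      ... | true with w ≟ γ w
      ...   | yes _ = ℚ.≤-reflexive (≡.sym (ℚ.*-zeroˡ (∑[ v < n ] b w v)))
      ...   | no  _ = subst (1ℚ + 1ℚ ≤_) (≡.sym (ℚ.*-identityˡ (∑[ v < n ] b w v))) (min-degree w κw)

    -- An oriented edge with a moved end either has a moved target or leads from a moved source to a
    -- fixed target. The previous two bounds show that the first kind already exhausts the count,
    -- leaving nothing for the second.
    boundary≤0 : ∑[ v < n ] ∑[ w < n ] (b v w * (moved v * δ w (γ w))) ≤ 0ℚ
    boundary≤0 = ≤-cancel (begin
      ∑[ v < n ] ∑[ w < n ] (b v w * (moved v * δ w (γ w))) + I
        ≡⟨ ∑∑-distrib-+ (λ v w → b v w * (moved v * δ w (γ w))) (λ v w → b v w * U w) ⟨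
      ∑[ v < n ] ∑[ w < n ] (b v w * (moved v * δ w (γ w)) + b v w * U w)
        ≡⟨ ∑∑-cong split ⟨
      ∑[ v < n ] ∑[ w < n ] (b v w * (1ℚ - δ v (γ v) * δ w (γ w)))
        ≤⟨ edges≤2U ⟩
      sum U + sum U
        ≤⟨ 2U≤incidences ⟩
      I ∎)
      where
      open ℚ.≤-Reasoning
      I = ∑[ v < n ] ∑[ w < n ] (b v w * U w)
      ≤-cancel : ∀ {x y} → x + y ≤ y → x ≤ 0ℚ
      ≤-cancel {x} {y} p = subst₂ _≤_ (solve 2 (λ x y → x :+ y :- y := x) refl x y) (ℚ.+-inverseʳ y)
        (ℚ.+-monoˡ-≤ (- y) p)
      split : ∀ v w → b v w * (1ℚ - δ v (γ v) * δ w (γ w)) ≡ b v w * (moved v * δ w (γ w)) + b v w * U w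
      split v w with E v w in Evw
      ... | false = solve 3 (λ x y z → con 0ℚ :* x := con 0ℚ :* y :+ con 0ℚ :* z) refl
                      (1ℚ - δ v (γ v) * δ w (γ w)) (moved v * δ w (γ w)) (U w)
      ... | true rewrite E⇒κ w v (trans (E-sym w v) Evw) =
        solve 2 (λ p q → con 1ℚ :* (con 1ℚ :- p :* q) := con 1ℚ :* ((con 1ℚ :- p) :* q) :+ con 1ℚ :* (con 1ℚ :* (con 1ℚ :- q)))
          refl (δ v (γ v)) (δ w (γ w))

    moved-≥0 : ∀ v → 0ℚ ≤ moved v
    moved-≥0 v with does (v ≟ γ v)
    ... | true  = ℚ.≤-refl
    ... | false = ℚ.nonNegative⁻¹ 1ℚ

    -- An edge from a moved to a fixed vertex would contribute 1 to the nonnegative sum in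
    -- `boundary≤0`.
    moved-spreads : ∀ {v w} → E v w ≡ true → γ v ≢ v → γ w ≢ w
    moved-spreads {v} {w} Evw γv≢v γw≡w = ≤⇒≯ 1≤0 (ℚ.positive⁻¹ 1ℚ)
      where
      t : Fin n → Fin n → ℚ
      t v w = b v w * (moved v * δ w (γ w))
      t≥0 : ∀ v w → 0ℚ ≤ t v w
      t≥0 v w = ind*-≥0 (E v w) (subst (0ℚ ≤_) (ℚ.*-comm (δ w (γ w)) (moved v))
        (ind*-≥0 (does (w ≟ γ w)) (moved-≥0 v)))
      t≡1 : t v w ≡ 1ℚ
      t≡1 = cong₂ _*_ (cong ind Evw) (cong₂ _*_ (cong (_-_ 1ℚ) (δ-≢ (γv≢v ∘ ≡.sym)))
              (trans (cong (δ w) γw≡w) (δ-refl w)))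
      1≤0 : 1ℚ ≤ 0ℚ
      1≤0 = subst (_≤ 0ℚ) t≡1 (ℚ.≤-trans (term≤sum (t≥0 v) w)
        (ℚ.≤-trans (term≤sum (λ v → sum-≥0 (t≥0 v)) v) boundary≤0))

    -- If one core vertex moves, then by connectedness all do, and `edges≤2U` counts every oriented
    -- edge. Their number is then at most twice the number of core vertices, against `excess`.
    fixes-all : ∀ v → κ v ≡ true → γ v ≡ v
    fixes-all v κv with γ v ≟ v
    ... | yes γv≡v = γv≡v
    ... | no  γv≢v = contradiction excess (≤⇒≯ (begin
      ∑[ v < n ] ∑[ w < n ] b v w
        ≡⟨ ∑∑-cong all-edges ⟩
      ∑[ v < n ] ∑[ w < n ] (b v w * (1ℚ - δ v (γ v) * δ w (γ w)))
        ≤⟨ edges≤2U ⟩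
      sum U + sum U
        ≤⟨ ℚ.+-mono-≤ U≤κ U≤κ ⟩
      ∑[ v < n ] ind (κ v) + ∑[ v < n ] ind (κ v) ∎))
      where
      open ℚ.≤-Reasoning
      spread : ∀ {v w} → Star (λ v w → E v w ≡ true) v w → γ v ≢ v → γ w ≢ w
      spread ε         = λ γv≢v → γv≢v
      spread (Evt ◅ p) = spread p ∘ moved-spreads Evt
      all-edges : ∀ x y → b x y ≡ b x y * (1ℚ - δ x (γ x) * δ y (γ y))
      all-edges x y with E x y in Exy
      ... | false = ≡.sym (ℚ.*-zeroˡ (1ℚ - δ x (γ x) * δ y (γ y)))
      ... | true rewrite δ-≢ (spread (connected v x κv (E⇒κ x y Exy)) γv≢v ∘ ≡.sym) =
        solve 1 (λ q → con 1ℚ := con 1ℚ :* (con 1ℚ :- con 0ℚ :* q)) refl (δ y (γ y))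
      U≤κ : sum U ≤ ∑[ v < n ] ind (κ v)
      U≤κ = sum-mono-≤ λ x → bound x
        where
        bound : ∀ x → U x ≤ ind (κ x)
        bound x with κ x | does (x ≟ γ x)
        ... | true  | true  = ℚ.nonNegative⁻¹ 1ℚ
        ... | true  | false = ℚ.≤-refl
        ... | false | true  = ℚ.≤-refl
        ... | false | false = ℚ.≤-refl

-- Peeling off leaves

countTrue≤n : (p : Fin n → Bool) → countTrue p ℕ.≤ n
countTrue≤n {ℕ.zero}  p = ℕ.z≤n
countTrue≤n {ℕ.suc n} p with p zero
... | true  = ℕ.s≤s (countTrue≤n (p ∘ suc))
... | false = ℕ.m≤n⇒m≤1+n (countTrue≤n (p ∘ suc))

countTrue-cong : {p q : Fin n → Bool} → (∀ i → p i ≡ q i) → countTrue p ≡ countTrue q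
countTrue-cong {ℕ.zero}  p≡q = refl
countTrue-cong {ℕ.suc n} p≡q = cong₂ (λ b k → (if b then 1 else 0) ℕ.+ k) (p≡q zero) (countTrue-cong (p≡q ∘ suc))

countTrue-mono-≤ : {p q : Fin n → Bool} → (∀ i → p i ≡ true → q i ≡ true) → countTrue p ℕ.≤ countTrue q
countTrue-mono-≤ {ℕ.zero}  p⇒q = ℕ.z≤n
countTrue-mono-≤ {ℕ.suc n} {p} {q} p⇒q with p zero in p₀ | q zero in q₀
... | true  | true  = ℕ.s≤s (countTrue-mono-≤ (p⇒q ∘ suc))
... | true  | false = contradiction (trans (≡.sym q₀) (p⇒q zero p₀)) λ ()
... | false | true  = ℕ.m≤n⇒m≤1+n (countTrue-mono-≤ (p⇒q ∘ suc))
... | false | false = countTrue-mono-≤ (p⇒q ∘ suc)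

countTrue-mono-< : {p q : Fin n → Bool} → (∀ i → p i ≡ true → q i ≡ true) →
  ∀ j → p j ≡ false → q j ≡ true → countTrue p ℕ.< countTrue q
countTrue-mono-< {p = p} {q} p⇒q zero pj qj rewrite pj | qj = ℕ.s≤s (countTrue-mono-≤ (p⇒q ∘ suc))
countTrue-mono-< {p = p} {q} p⇒q (suc j) pj qj with p zero in p₀ | q zero in q₀
... | true  | true  = ℕ.s≤s (countTrue-mono-< (p⇒q ∘ suc) j pj qj)
... | true  | false = contradiction (trans (≡.sym q₀) (p⇒q zero p₀)) λ ()
... | false | true  = ℕ.m≤n⇒m≤1+n (countTrue-mono-< (p⇒q ∘ suc) j pj qj)
... | false | false = countTrue-mono-< (p⇒q ∘ suc) j pj qj

countTrue-full : {p : Fin n → Bool} → n ℕ.≤ countTrue p → ∀ i → p i ≡ true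
countTrue-full {n = ℕ.suc n} {p} n≤ i with p zero in p₀
countTrue-full n≤         zero    | true  = p₀
countTrue-full (ℕ.s≤s n≤) (suc i) | true  = countTrue-full n≤ i
countTrue-full {p = p} n≤ i       | false = contradiction (ℕ.≤-trans n≤ (countTrue≤n (p ∘ suc))) ℕ.1+n≰n

countTrue-pos : {p : Fin n → Bool} → ∀ i → p i ≡ true → 1 ℕ.≤ countTrue p
countTrue-pos {p = p} zero    pi rewrite pi = ℕ.s≤s ℕ.z≤n
countTrue-pos {p = p} (suc i) pi = ℕ.≤-trans (countTrue-pos i pi) (ℕ.m≤n+m _ _)

countTrue-∃ : {p : Fin n → Bool} → 1 ℕ.≤ countTrue p → ∃ λ i → p i ≡ true
countTrue-∃ {ℕ.suc n} {p} 1≤ with p zero in p₀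
... | true  = zero , p₀
... | false = map suc (λ pi → pi) (countTrue-∃ 1≤)

countTrue-unique : {p : Fin n → Bool} → countTrue p ≡ 1 → ∀ i j → p i ≡ true → p j ≡ true → i ≡ j
countTrue-unique one zero    zero    pi pj = refl
countTrue-unique {p = p} one zero (suc j) pi pj rewrite pi =
  contradiction (subst (1 ℕ.≤_) (ℕ.suc-injective one) (countTrue-pos j pj)) λ ()
countTrue-unique {p = p} one (suc i) zero pi pj rewrite pj =
  contradiction (subst (1 ℕ.≤_) (ℕ.suc-injective one) (countTrue-pos i pi)) λ ()
countTrue-unique {p = p} one (suc i) (suc j) pi pj with p zero
... | true  = contradiction (subst (1 ℕ.≤_) (ℕ.suc-injective one) (countTrue-pos i pi)) λ ()
... | false = cong suc (countTrue-unique one i j pi pj)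

-- Counts as rationals and the handshake lemma

infixr 8 _·1
_·1 : ℕ → ℚ
k ·1 = k × 1ℚ

∑-ind : (p : Fin n → Bool) → ∑[ i < n ] ind (p i) ≡ countTrue p ·1
∑-ind {ℕ.zero}  p = refl
∑-ind {ℕ.suc n} p with p zero
... | true  = cong (1ℚ +_) (∑-ind (p ∘ suc))
... | false = trans (ℚ.+-identityˡ _) (∑-ind (p ∘ suc))

∑-·1 : (f : Fin n → ℕ) → ∑[ i < n ] (f i ·1) ≡ sumFin f ·1
∑-·1 {ℕ.zero}  f = refl
∑-·1 {ℕ.suc n} f = trans (cong (f zero ·1 +_) (∑-·1 (f ∘ suc))) (≡.sym (×-homo-+ 1ℚ (f zero) (sumFin (f ∘ suc))))

·1-≥0 : ∀ k → 0ℚ ≤ k ·1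
·1-≥0 ℕ.zero    = ℚ.≤-refl
·1-≥0 (ℕ.suc k) = ℚ.+-mono-≤ (ℚ.nonNegative⁻¹ 1ℚ) (·1-≥0 k)

·1-mono-≤ : ∀ {k l} → k ℕ.≤ l → k ·1 ≤ l ·1
·1-mono-≤ {l = l} ℕ.z≤n = ·1-≥0 l
·1-mono-≤ (ℕ.s≤s k≤l)   = ℚ.+-monoʳ-≤ 1ℚ (·1-mono-≤ k≤l)

·1-mono-< : ∀ {k l} → k ℕ.< l → k ·1 < l ·1
·1-mono-< {k} k<l = ℚ.<-≤-trans (subst (_< ℕ.suc k ·1) (ℚ.+-identityˡ (k ·1)) (ℚ.+-monoˡ-< (k ·1) (ℚ.positive⁻¹ 1ℚ)))
  (·1-mono-≤ k<l)

<ᵇ-asym : ∀ k l → k ≢ l → (l ℕ.<ᵇ k) ≡ not (k ℕ.<ᵇ l)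
<ᵇ-asym ℕ.zero    ℕ.zero    k≢l = contradiction refl k≢l
<ᵇ-asym ℕ.zero    (ℕ.suc l) k≢l = refl
<ᵇ-asym (ℕ.suc k) ℕ.zero    k≢l = refl
<ᵇ-asym (ℕ.suc k) (ℕ.suc l) k≢l = <ᵇ-asym k l (k≢l ∘ cong ℕ.suc)

-- `edgeCount` lists each edge once, directed towards the larger index; adding the reversed
-- directions recovers the whole adjacency relation.
handshake : (G : Graph n) → ∑[ v < n ] ∑[ w < n ] ind (adj G v w) ≡ edgeCount G ·1 + edgeCount G ·1
handshake {n} G = begin
  ∑[ v < n ] ∑[ w < n ] ind (adj G v w)
    ≡⟨ ∑∑-cong orient ⟨
  ∑[ v < n ] ∑[ w < n ] (up v w + up w v)
    ≡⟨ ∑∑-symmetrise up ⟨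
  ∑[ v < n ] ∑[ w < n ] up v w + ∑[ v < n ] ∑[ w < n ] up v w
    ≡⟨ cong₂ _+_ count count ⟩
  edgeCount G ·1 + edgeCount G ·1 ∎
  where
  open ≡.≡-Reasoning
  up : Fin n → Fin n → ℚ
  up v w = ind (adj G v w ∧ (toℕ v ℕ.<ᵇ toℕ w))
  orient : ∀ v w → up v w + up w v ≡ ind (adj G v w)
  orient v w rewrite Graph.sym G w v with adj G v w in Avw
  ... | false = refl
  ... | true rewrite <ᵇ-asym (toℕ v) (toℕ w)
                       (λ v≡w → contradiction (trans (≡.sym Avw) (trans (cong (adj G v) (≡.sym (toℕ-injective v≡w))) (irrefl G v))) λ ())
                with toℕ v ℕ.<ᵇ toℕ w
  ...   | true  = refl
  ...   | false = refl
  count : ∑[ v < n ] ∑[ w < n ] up v w ≡ edgeCount G ·1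
  count = trans (sum-cong-≗ λ v → ∑-ind (λ w → adj G v w ∧ (toℕ v ℕ.<ᵇ toℕ w)))
    (∑-·1 λ v → countTrue (λ w → adj G v w ∧ (toℕ v ℕ.<ᵇ toℕ w)))

-- Connectivity and edge excess under removal of leaves

adjOff : Graph n → (Fin n → Bool) → Fin n → Fin n → Bool
adjOff G R v w = adj G v w ∧ (not (R v) ∧ not (R w))

WalkOff : Graph n → (Fin n → Bool) → Fin n → Fin n → Set
WalkOff G R = Star λ v w → adjOff G R v w ≡ true

-- One step of `removedUpTo`: `removedUpTo G (suc k)` unfolds to `peel G (removedUpTo G k)`, so
-- statements about `peel` iterate directly.
peel : Graph n → (Fin n → Bool) → Fin n → Bool
peel G R v = R v ∨ leafRem G R v

module _ (G : Graph n) where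

  adjOff-sym : ∀ R v w → adjOff G R v w ≡ adjOff G R w v
  adjOff-sym R v w = cong₂ _∧_ (Graph.sym G v w) (∧-comm (not (R v)) (not (R w)))

  adjOff-irrefl : ∀ R v → adjOff G R v v ≡ false
  adjOff-irrefl R v rewrite irrefl G v = refl

  adjOff⁺ : ∀ R {v w} → adj G v w ≡ true → R v ≡ false → R w ≡ false → adjOff G R v w ≡ true
  adjOff⁺ R Avw Rv Rw rewrite Avw | Rv | Rw = refl

  adjOff⇒adj : ∀ R {v w} → adjOff G R v w ≡ true → adj G v w ≡ true
  adjOff⇒adj R = ∧-conicalˡ _ _

  adjOff⇒source : ∀ R {v w} → adjOff G R v w ≡ true → R v ≡ false
  adjOff⇒source R {v} {w} Evw with adj G v w | R v
  ... | true | false = refl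

  adjOff⇒target : ∀ R {v w} → adjOff G R v w ≡ true → R w ≡ false
  adjOff⇒target R {v} {w} Evw with adj G v w | R v | R w
  ... | true | false | false = refl

  leaf⇒present : ∀ R v → leafRem G R v ≡ true → R v ≡ false
  leaf⇒present R v Lv with R v
  ... | false = refl

  leaf⇒degree1 : ∀ R v → leafRem G R v ≡ true → degRem G R v ≡ 1
  leaf⇒degree1 R v Lv = ℕ.≡ᵇ⇒≡ _ _ (subst T (≡.sym (∧-conicalʳ _ _ Lv)) tt)

  degRem-adjOff : ∀ R v → R v ≡ false → ∑[ w < n ] ind (adjOff G R v w) ≡ degRem G R v ·1
  degRem-adjOff R v Rv rewrite Rv = ∑-ind (λ w → adj G v w ∧ not (R w))

  leaf-neighbour : ∀ R v → leafRem G R v ≡ true → ∃ λ w → adjOff G R v w ≡ true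
  leaf-neighbour R v Lv with countTrue-∃ (ℕ.≤-reflexive (≡.sym (leaf⇒degree1 R v Lv)))
  ... | w , Avw rewrite leaf⇒present R v Lv = w , Avw

  leaf-neighbour-unique : ∀ R {v w t} → leafRem G R v ≡ true →
    adjOff G R v w ≡ true → adjOff G R v t ≡ true → w ≡ t
  leaf-neighbour-unique R {v} {w} {t} Lv Evw Evt =
    countTrue-unique (leaf⇒degree1 R v Lv) w t (trim Evw) (trim Evt)
    where
    trim : ∀ {w} → adjOff G R v w ≡ true → adj G v w ∧ not (R w) ≡ true
    trim {w} Evw rewrite adjOff⇒adj R Evw | adjOff⇒target R {v} {w} Evw = refl

  peel⇒not-leaf : ∀ R {v} → peel G R v ≡ false → leafRem G R v ≡ false
  peel⇒not-leaf R = ∨-conicalʳ _ _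

  peel-present : ∀ R {v} → peel G R v ≡ false → R v ≡ false
  peel-present R = ∨-conicalˡ _ _

  -- A walk between surviving vertices visits a leaf only to turn back, so these visits can be cut out.
  walk-peel : ∀ R {v w} → WalkOff G R v w → peel G R v ≡ false → peel G R w ≡ false → WalkOff G (peel G R) v w
  walk-peel R ε Pv Pw = ε
  walk-peel R {v} (_◅_ {j = t} Evt p) Pv Pw with leafRem G R t in Lt
  walk-peel R {v} (_◅_ {j = t} Evt p) Pv Pw | false =
    adjOff⁺ (peel G R) (adjOff⇒adj R Evt) Pv Pt ◅ walk-peel R p Pt Pw
    where
    Pt : peel G R t ≡ false
    Pt = cong₂ _∨_ (adjOff⇒target R {v} Evt) Lt
  walk-peel R {v} (Evt ◅ ε) Pv Pw | true = contradiction (trans (≡.sym Lt) (peel⇒not-leaf R Pw)) λ ()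
  walk-peel R {v} (_◅_ {j = t} Evt (_◅_ {j = s} Ets p)) Pv Pw | true
    with refl ← leaf-neighbour-unique R Lt (trans (adjOff-sym R t v) Evt) Ets = walk-peel R p Pv Pw

  -- The inequality |V| < |E| for the remaining graph, doubled because the right side counts
  -- oriented edges.
  Excess : (Fin n → Bool) → Set
  Excess R = ∑[ v < n ] ind (not (R v)) + ∑[ v < n ] ind (not (R v)) <
    ∑[ v < n ] ∑[ w < n ] ind (adjOff G R v w)

  -- Every leaf that disappears takes at most one edge with it, so |E| - |V| does not decrease.
  excess-peel : ∀ R → Excess R → Excess (peel G R)
  excess-peel R excess = cancel (begin-strict
    (sum P' + sum P') + (sum L + sum L)
      ≡⟨ solve 2 (λ p l → (p :+ p) :+ (l :+ l) := (p :+ l) :+ (p :+ l)) refl (sum P') (sum L) ⟩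
    (sum P' + sum L) + (sum P' + sum L)
      ≡⟨ cong₂ _+_ count count ⟨
    sum P + sum P
      <⟨ excess ⟩
    ∑[ v < n ] ∑[ w < n ] B v w
      ≤⟨ sum-mono-≤ (λ v → sum-mono-≤ (λ w → edge-bound v w)) ⟩
    ∑[ v < n ] ∑[ w < n ] (B' v w + (L v * B v w + L w * B w v))
      ≡⟨ trans (∑∑-distrib-+ B' (λ v w → L v * B v w + L w * B w v))
           (cong (sum (sum ∘ B') +_) (≡.sym (∑∑-symmetrise (λ v w → L v * B v w)))) ⟩
    ∑[ v < n ] ∑[ w < n ] B' v w + (∑[ v < n ] ∑[ w < n ] (L v * B v w) + ∑[ v < n ] ∑[ w < n ] (L v * B v w))
      ≡⟨ cong (sum (sum ∘ B') +_) (cong₂ _+_ leaf-edges leaf-edges) ⟩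
    ∑[ v < n ] ∑[ w < n ] B' v w + (sum L + sum L) ∎)
    where
    open ℚ.≤-Reasoning
    P P' L : Fin n → ℚ
    P v  = ind (not (R v))
    P' v = ind (not (peel G R v))
    L v  = ind (leafRem G R v)
    B B' : Fin n → Fin n → ℚ
    B v w  = ind (adjOff G R v w)
    B' v w = ind (adjOff G (peel G R) v w)
    cancel : ∀ {x y z} → x + z < y + z → x < y
    cancel {x} {y} {z} lt = subst₂ _<_ (undo x) (undo y) (ℚ.+-monoˡ-< (- z) lt)
      where
      undo : ∀ x → x + z - z ≡ x
      undo x = solve 2 (λ x z → x :+ z :- z := x) refl x z
    count : sum P ≡ sum P' + sum L
    count = trans (sum-cong-≗ λ v → split v) (∑-distrib-+ P' L)
      where
      split : ∀ v → P v ≡ P' v + L v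
      split v with leafRem G R v in Lv
      ... | true rewrite leaf⇒present R v Lv = refl
      ... | false with R v
      ...   | true  = refl
      ...   | false = refl
    leaf-edges : ∑[ v < n ] ∑[ w < n ] (L v * B v w) ≡ sum L
    leaf-edges = sum-cong-≗ λ v → trans (≡.sym (*-distribˡ-sum (L v) (B v))) (one v)
      where
      one : ∀ v → L v * sum (B v) ≡ L v
      one v with leafRem G R v in Lv
      ... | false = ℚ.*-zeroˡ (sum (B v))
      ... | true  = trans (ℚ.*-identityˡ (sum (B v)))
        (trans (degRem-adjOff R v (leaf⇒present R v Lv)) (cong _·1 (leaf⇒degree1 R v Lv)))
    edge-bound : ∀ v w → B v w ≤ B' v w + (L v * B v w + L w * B w v)
    edge-bound v w rewrite adjOff-sym R w v = go (adj G v w) (R v) (R w) (leafRem G R v) (leafRem G R w)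
      where
      go : ∀ a r s l k → let e = ind (a ∧ (not r ∧ not s)) in
        e ≤ ind (a ∧ (not (r ∨ l) ∧ not (s ∨ k))) + (ind l * e + ind k * e)
      go false r     s     false false = ℚ.≤-refl
      go false r     s     false true  = ℚ.≤-refl
      go false r     s     true  false = ℚ.≤-refl
      go false r     s     true  true  = ℚ.≤-refl
      go true  true  s     false false = ℚ.≤-refl
      go true  true  s     false true  = ℚ.≤-refl
      go true  true  s     true  false = ℚ.≤-refl
      go true  true  s     true  true  = ℚ.≤-refl
      go true  false true  false false = ℚ.≤-refl
      go true  false true  false true  = ℚ.≤-refl
      go true  false true  true  false = ℚ.≤-refl
      go true  false true  true  true  = ℚ.≤-refl
      go true  false false false false = ℚ.≤-refl
      go true  false false false true  = ℚ.≤-refl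
      go true  false false true  false = ℚ.≤-refl
      -- An edge joining two leaves is charged to both of them; this is the only case with slack.
      go true  false false true  true  = ℚ.+-monoʳ-≤ 1ℚ (ℚ.nonNegative⁻¹ 1ℚ)

  Stable : (Fin n → Bool) → Set
  Stable R = ∀ v → leafRem G R v ≡ false

  Stable-cong : ∀ {R R'} → (∀ v → R v ≡ R' v) → Stable R → Stable R'
  Stable-cong R≡R' stable v = trans (cong₂ (λ r d → not r ∧ (d ℕ.≡ᵇ 1)) (≡.sym (R≡R' v))
    (countTrue-cong λ w → cong (λ r → adj G v w ∧ not r) (≡.sym (R≡R' w)))) (stable v)

  -- A step that finds a leaf removes at least one new vertex, and a step that finds none changes
  -- nothing afterwards.
  stable-or-large : ∀ k → Stable (removedUpTo G k) ⊎ k ℕ.≤ countTrue (removedUpTo G k)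
  stable-or-large ℕ.zero    = inj₂ ℕ.z≤n
  stable-or-large (ℕ.suc k) with any? (λ v → leafRem G (removedUpTo G k) v Bool.≟ true) | stable-or-large k
  ... | no  none     | _ = inj₁ (Stable-cong (λ v → ≡.sym (trans (cong (R v ∨_) (none' v)) (∨-identityʳ (R v)))) none')
    where
    R = removedUpTo G k
    none' : Stable R
    none' v = Bool.¬-not λ Lv → none (v , Lv)
  ... | yes (v , Lv) | inj₁ stable = contradiction (trans (≡.sym Lv) (stable v)) λ ()
  ... | yes (v , Lv) | inj₂ k≤     = inj₂ (ℕ.≤-<-trans k≤ (countTrue-mono-<
    (λ i Ri → cong (_∨ leafRem G R i) Ri) v (leaf⇒present R v Lv)
    (trans (cong (R v ∨_) Lv) (∨-zeroʳ (R v)))))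
    where R = removedUpTo G k

  -- If the `n` steps have removed `n` vertices, no vertex remains that could be a leaf.
  forestCore-stable : Stable (forestCore G)
  forestCore-stable with stable-or-large n
  ... | inj₁ stable = stable
  ... | inj₂ n≤     = λ v → cong (λ r → not r ∧ (degRem G (forestCore G) v ℕ.≡ᵇ 1)) (countTrue-full n≤ v)

-- The core and extension of functions over the forest

module Core (G : Graph n) (conn : Connected G) (betti≥2 : betti1 G ≥ 2) where

  private
    R : ℕ → Fin n → Bool
    R = removedUpTo G

  connectedOff : ∀ k v w → R k v ≡ false → R k w ≡ false → WalkOff G (R k) v w
  connectedOff ℕ.zero    v w _  _  = walk (conn v w)
    where
    walk : ∀ {v w} → Walk G v w → WalkOff G (R 0) v w
    walk here         = ε
    walk (step Avt p) = adjOff⁺ G (R 0) Avt refl refl ◅ walk p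
  connectedOff (ℕ.suc k) v w Rv Rw = walk-peel G (R k) (connectedOff k v w (peel-present G (R k) Rv) (peel-present G (R k) Rw)) Rv Rw

  n<edgeCount : n ℕ.< edgeCount G
  n<edgeCount = ℕ.≰⇒> λ E≤n → contradiction
    (ℕ.≤-trans betti≥2 (ℕ.m≤n+o⇒m∸n≤o (edgeCount G ℕ.+ 1) n (ℕ.+-monoˡ-≤ 1 E≤n))) (ℕ.<⇒≱ ℕ.≤-refl)

  excess : ∀ k → Excess G (R k)
  excess ℕ.zero = subst₂ _<_ (≡.sym (cong₂ _+_ ones ones))
    (trans (≡.sym (handshake G)) (∑∑-cong λ v w → cong ind (≡.sym (∧-identityʳ (adj G v w)))))
    (ℚ.+-mono-< (·1-mono-< n<edgeCount) (·1-mono-< n<edgeCount))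
    where
    ones : ∑[ v < n ] 1ℚ ≡ n ·1
    ones = sum-replicate n
  excess (ℕ.suc k) = excess-peel G (R k) (excess k)

  -- Without edges in the core, `excess` would put a nonnegative number below zero. The edge also
  -- supplies the base point `root`.
  core-edge : ∃ λ v → ∃ λ w → adjOff G (forestCore G) v w ≡ true
  core-edge with any? (λ v → any? λ w → adjOff G (forestCore G) v w Bool.≟ true)
  ... | yes edge = edge
  ... | no  none = contradiction (excess n) (≤⇒≯ (ℚ.≤-trans
    (ℚ.≤-reflexive (sum-zero λ v → sum-zero λ w → cong ind (Bool.¬-not λ Evw → none (v , w , Evw))))
    (ℚ.+-mono-≤ core≥0 core≥0)))
    where
    core≥0 : 0ℚ ≤ ∑[ v < n ] ind (inCyc G v)
    core≥0 = sum-≥0 λ v → ind-≥0 (inCyc G v)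

  root : Fin n
  root = proj₁ core-edge

  root∈core : forestCore G root ≡ false
  root∈core = adjOff⇒source G (forestCore G) (proj₂ (proj₂ core-edge))

  core-degree≥1 : ∀ v → forestCore G v ≡ false → ∃ λ w → adjOff G (forestCore G) v w ≡ true
  core-degree≥1 v Fv with connectedOff n v root Fv root∈core
  ... | ε       = proj₂ core-edge
  ... | Evw ◅ _ = _ , Evw

  -- A walk to `root` provides one neighbour, and stability of the peeling excludes degree exactly
  -- 1.
  core-degree≥2 : ∀ v → forestCore G v ≡ false → 1ℚ + 1ℚ ≤ ∑[ w < n ] ind (adjOff G (forestCore G) v w)
  core-degree≥2 v Fv = subst (1ℚ + 1ℚ ≤_) (≡.sym (degRem-adjOff G F v Fv)) (·1-mono-≤ {2} degree≥2)
    where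
    F = forestCore G
    degree≥1 : 1 ℕ.≤ degRem G F v
    degree≥1 with core-degree≥1 v Fv
    ... | w , Evw = countTrue-pos w (trans (cong₂ _∧_ (adjOff⇒adj G F Evw) (cong not (adjOff⇒target G F {v} Evw))) refl)
    degree≢1 : degRem G F v ≢ 1
    degree≢1 eq = contradiction (trans (≡.sym (cong₂ (λ r d → not r ∧ (d ℕ.≡ᵇ 1)) Fv eq)) (forestCore-stable G v)) λ ()
    degree≥2 : 2 ℕ.≤ degRem G F v
    degree≥2 = ℕ.≤∧≢⇒< degree≥1 (degree≢1 ∘ ≡.sym)

  -- Here and below `d` is the number of peeling steps still to come after stage `k`; the recursion
  -- goes back from the final stage `n`.
  core-present : ∀ d {k} → d ℕ.+ k ≡ n → ∀ {v} → forestCore G v ≡ false → R k v ≡ false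
  core-present ℕ.zero    refl Fv = Fv
  core-present (ℕ.suc d) {k} eq Fv = peel-present G (R k) (core-present d (trans (ℕ.+-suc d k) eq) Fv)

  -- Otherwise the two leaves would form a whole component of the remaining graph.
  leaves-nonadjacent : ∀ d {k} → ℕ.suc d ℕ.+ k ≡ n → ∀ {v w} → adjOff G (R k) v w ≡ true →
    leafRem G (R k) v ≡ true → leafRem G (R k) w ≢ true
  leaves-nonadjacent d {k} eq {v} Evw Lv Lw = contradiction
    (trans (≡.sym (trapped (connectedOff k v root (leaf⇒present G (R k) v Lv) (peel-present G (R k) root-present)) Evw Lv Lw))
      (peel⇒not-leaf G (R k) root-present)) λ ()
    where
    root-present : R (ℕ.suc k) root ≡ false
    root-present = core-present d (trans (ℕ.+-suc d k) eq) root∈core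
    trapped : ∀ {v w z} → WalkOff G (R k) v z → adjOff G (R k) v w ≡ true →
      leafRem G (R k) v ≡ true → leafRem G (R k) w ≡ true → leafRem G (R k) z ≡ true
    trapped ε Evw Lv Lw = Lv
    trapped {v} {w} (Evt ◅ p) Evw Lv Lw with refl ← leaf-neighbour-unique G (R k) Lv Evw Evt =
      trapped p (trans (adjOff-sym G (R k) w v) Evw) Lw Lv

  -- Each removed leaf is computed from the only neighbour it has when it is removed.
  module Propagate {X : Set} (base : Fin n → X) (next : Fin n → Fin n → X → X) where

    -- A disjunction, because either end of a forest edge may be the one removed first and hence
    -- computed from the other.
    Linked : (Fin n → X) → Fin n → Fin n → Set
    Linked φ v w = φ v ≡ next v w (φ w) ⊎ φ w ≡ next w v (φ v)

    private
      -- The leaf test is passed with its equation: the equation yields the neighbour in the leaf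
      -- case, and lemmas can match on `b`.
      extendTo : ∀ k → (Fin n → X) → ∀ v b → leafRem G (R k) v ≡ b → X
      extendTo k φ v true  Lv = let w = proj₁ (leaf-neighbour G (R k) v Lv) in next v w (φ w)
      extendTo k φ v false _  = φ v

      -- Runs the peeling backwards: at `k = n` only the base values are present, and each decrease
      -- of `k` overwrites the values at the leaves removed in step `k`.
      stage : ℕ → ℕ → Fin n → X
      stage ℕ.zero    k = base
      stage (ℕ.suc d) k v = extendTo k (stage d (ℕ.suc k)) v (leafRem G (R k) v) refl

      extendTo-leaf : ∀ k φ {v w} b (Lv : leafRem G (R k) v ≡ b) → b ≡ true → adjOff G (R k) v w ≡ true →
        extendTo k φ v b Lv ≡ next v w (φ w)
      extendTo-leaf k φ {v} true Lv _ Evw with leaf-neighbour G (R k) v Lv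
      ... | t , Evt = cong (λ t → next v t (φ t)) (leaf-neighbour-unique G (R k) Lv Evt Evw)

      extendTo-other : ∀ k φ {v} b (Lv : leafRem G (R k) v ≡ b) → b ≡ false → extendTo k φ v b Lv ≡ φ v
      extendTo-other k φ false Lv _ = refl

      stage-leaf : ∀ d k {v w} → leafRem G (R k) v ≡ true → adjOff G (R k) v w ≡ true →
        stage (ℕ.suc d) k v ≡ next v w (stage d (ℕ.suc k) w)
      stage-leaf d k = extendTo-leaf k (stage d (ℕ.suc k)) _ refl

      stage-other : ∀ d k {v} → leafRem G (R k) v ≡ false → stage (ℕ.suc d) k v ≡ stage d (ℕ.suc k) v
      stage-other d k = extendTo-other k (stage d (ℕ.suc k)) _ refl

      -- If just one end is a leaf, its value is computed from the other end, which this stage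
      -- leaves unchanged. Two leaves cannot be adjacent, and an edge without leaf ends survives to
      -- the next stage.
      stage-linked : ∀ d k → d ℕ.+ k ≡ n → ∀ {v w} → adjOff G (R k) v w ≡ true →
        forestCore G v ∨ forestCore G w ≡ true → Linked (stage d k) v w
      stage-linked ℕ.zero k refl {v} {w} Evw Fvw = contradiction
        (trans (≡.sym Fvw) (cong₂ _∨_ (adjOff⇒source G (R k) Evw) (adjOff⇒target G (R k) {v} Evw))) λ ()
      stage-linked (ℕ.suc d) k eq {v} {w} Evw Fvw with leafRem G (R k) v Bool.≟ true | leafRem G (R k) w Bool.≟ true
      ... | yes Lv | yes Lw = contradiction Lw (leaves-nonadjacent d eq Evw Lv)
      ... | yes Lv | no ¬Lw = inj₁ (trans (stage-leaf d k Lv Evw)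
        (cong (next v w) (≡.sym (stage-other d k (Bool.¬-not ¬Lw)))))
      ... | no ¬Lv | yes Lw = inj₂ (trans (stage-leaf d k Lw (trans (adjOff-sym G (R k) w v) Evw))
        (cong (next w v) (≡.sym (stage-other d k (Bool.¬-not ¬Lv)))))
      ... | no ¬Lv | no ¬Lw = subst₂ (λ x y → x ≡ next v w y ⊎ y ≡ next w v x)
        (≡.sym (stage-other d k (Bool.¬-not ¬Lv))) (≡.sym (stage-other d k (Bool.¬-not ¬Lw)))
        (stage-linked d (ℕ.suc k) (trans (ℕ.+-suc d k) eq)
          (adjOff⁺ G (R (ℕ.suc k)) (adjOff⇒adj G (R k) Evw)
            (cong₂ _∨_ (adjOff⇒source G (R k) Evw) (Bool.¬-not ¬Lv))
            (cong₂ _∨_ (adjOff⇒target G (R k) {v} Evw) (Bool.¬-not ¬Lw)))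
          Fvw)

      stage-core : ∀ d k → d ℕ.+ k ≡ n → ∀ {v} → forestCore G v ≡ false → stage d k v ≡ base v
      stage-core ℕ.zero    k eq Fv = refl
      stage-core (ℕ.suc d) k eq Fv = trans
        (stage-other d k (peel⇒not-leaf G (R k) (core-present d (trans (ℕ.+-suc d k) eq) Fv)))
        (stage-core d (ℕ.suc k) (trans (ℕ.+-suc d k) eq) Fv)

    propagate : Fin n → X
    propagate = stage n 0

    propagate-core : ∀ {v} → forestCore G v ≡ false → propagate v ≡ base v
    propagate-core = stage-core n 0 (ℕ.+-identityʳ n)

    propagate-linked : ∀ v w → edgeF G v w ≡ true → Linked propagate v w
    propagate-linked v w Fvw = stage-linked n 0 (ℕ.+-identityʳ n)
      (adjOff⁺ G (R 0) {v} {w} (∧-conicalˡ _ _ Fvw) refl refl) (∧-conicalʳ _ _ Fvw)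

  open Propagate

  -- Copying values outwards from the identity on the core sends a forest vertex to the core vertex
  -- where its tree is attached.
  attachment : Fin n → Fin n
  attachment = propagate (λ v → v) (λ _ _ x → x)

  attachment-core : ∀ {v} → forestCore G v ≡ false → attachment v ≡ v
  attachment-core = propagate-core (λ v → v) (λ _ _ x → x)

  attachment-edge : ∀ v w → edgeF G v w ≡ true → attachment v ≡ attachment w
  attachment-edge v w Fvw with propagate-linked (λ v → v) (λ _ _ x → x) v w Fvw
  ... | inj₁ eq = eq
  ... | inj₂ eq = ≡.sym eq

  -- Integrates `f` outwards along the trees, starting from 0 on the core. Antisymmetry of `f`
  -- handles the edges whose second end is the one computed.
  forest-potential : (f : Ω1 G) → ∃ λ (u : Fin n → ℚ) → ∀ v w → edgeF G v w ≡ true → proj₁ f v w ≡ u w - u v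
  forest-potential (f , f-anti) = u , edge
    where
    u : Fin n → ℚ
    u = propagate (λ _ → 0ℚ) (λ v w x → x - f v w)
    edge : ∀ v w → edgeF G v w ≡ true → f v w ≡ u w - u v
    edge v w Fvw with propagate-linked (λ _ → 0ℚ) (λ v w x → x - f v w) v w Fvw
    ... | inj₁ uv≡ = trans (solve 2 (λ f x → f := x :- (x :- f)) refl (f v w) (u w)) (cong (_-_ (u w)) (≡.sym uv≡))
    ... | inj₂ uw≡ = trans (f-anti v w (∧-conicalˡ _ _ Fvw)) (trans
      (solve 2 (λ f x → :- f := (x :- f) :- x) refl (f w v) (u v)) (cong (_- u v) (≡.sym uw≡)))

-- Automorphisms

countTrue-sum : (p : Fin n → Bool) → countTrue p ≡ Sumℕ.sum (λ i → if p i then 1 else 0)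
countTrue-sum {ℕ.zero}  p = refl
countTrue-sum {ℕ.suc n} p = cong ((if p zero then 1 else 0) ℕ.+_) (countTrue-sum (p ∘ suc))

countTrue-permute : (π : Permutation′ n) (p : Fin n → Bool) → countTrue (λ i → p (π ⟨$⟩ʳ i)) ≡ countTrue p
countTrue-permute π p = trans (countTrue-sum (λ i → p (π ⟨$⟩ʳ i)))
  (≡.sym (trans (countTrue-sum p) (Sumℕ.sum-permute (λ i → if p i then 1 else 0) π)))

-- Restriction to an invariant set, extended by the identity

restrict : (π : Permutation′ n) (S : Fin n → Bool) → (∀ v → S (π ⟨$⟩ʳ v) ≡ S v) → Permutation′ n
restrict {n} π S S-inv = permutation to from to∘from from∘to
  where
  to from : Fin n → Fin n
  to v   = if S v then π ⟨$⟩ʳ v else v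
  from v = if S v then π ⟨$⟩ˡ v else v
  S-inv⁻¹ : ∀ v → S (π ⟨$⟩ˡ v) ≡ S v
  S-inv⁻¹ v = trans (≡.sym (S-inv (π ⟨$⟩ˡ v))) (cong S (inverseʳ π))
  to∘from : ∀ v → to (from v) ≡ v
  to∘from v with S v in Sv
  ... | true  rewrite trans (S-inv⁻¹ v) Sv = inverseʳ π
  ... | false rewrite Sv = refl
  from∘to : ∀ v → from (to v) ≡ v
  from∘to v with S v in Sv
  ... | true  rewrite trans (S-inv v) Sv = inverseˡ π
  ... | false rewrite Sv = refl

module _ (π : Permutation′ n) (S : Fin n → Bool) (S-inv : ∀ v → S (π ⟨$⟩ʳ v) ≡ S v) where

  restrict-in : ∀ {v} → S v ≡ true → restrict π S S-inv ⟨$⟩ʳ v ≡ π ⟨$⟩ʳ v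
  restrict-in Sv rewrite Sv = refl

  restrict-in⁻¹ : ∀ {v} → S v ≡ true → restrict π S S-inv ⟨$⟩ˡ v ≡ π ⟨$⟩ˡ v
  restrict-in⁻¹ Sv rewrite Sv = refl

  restrict-out : ∀ {v} → S v ≡ false → restrict π S S-inv ⟨$⟩ʳ v ≡ v
  restrict-out Sv rewrite Sv = refl

  restrict-preserves : ∀ v → S (restrict π S S-inv ⟨$⟩ʳ v) ≡ S v
  restrict-preserves v with S v in Sv
  ... | true  = trans (S-inv v) Sv
  ... | false = Sv

module _ (G : Graph n) where

  inverse-aut : Aut G → Aut G
  inverse-aut (π , π-adj) = flip π , λ i j → trans (≡.sym (π-adj (π ⟨$⟩ˡ i) (π ⟨$⟩ˡ j)))
    (cong₂ (adj G) (inverseʳ π) (inverseʳ π))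

  infixr 9 _∘A_
  _∘A_ : Aut G → Aut G → Aut G
  (π , π-adj) ∘A (ρ , ρ-adj) = ρ ∘ₚ π , λ i j → trans (π-adj (ρ ⟨$⟩ʳ i) (ρ ⟨$⟩ʳ j)) (ρ-adj i j)

  module _ (g : Aut G) where

    private
      count-neighbours : ∀ v {p q : Fin n → Bool} → (∀ w → p (⟦ g ⟧ w) ≡ q w) →
        countTrue (λ w → adj G (⟦ g ⟧ v) w ∧ p w) ≡ countTrue (λ w → adj G v w ∧ q w)
      count-neighbours v {p} p∘g≡q = trans (≡.sym (countTrue-permute (proj₁ g) (λ w → adj G (⟦ g ⟧ v) w ∧ p w)))
        (countTrue-cong λ w → cong₂ _∧_ (proj₂ g v w) (p∘g≡q w))

    -- Being a leaf depends only on a count of remaining neighbours, which an automorphism permutes;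
    -- so every peeling stage is invariant.
    removed-aut : ∀ k v → removedUpTo G k (⟦ g ⟧ v) ≡ removedUpTo G k v
    removed-aut ℕ.zero    v = refl
    removed-aut (ℕ.suc k) v = cong₂ (λ r d → r ∨ (not r ∧ (d ℕ.≡ᵇ 1))) (removed-aut k v)
      (count-neighbours v λ w → cong not (removed-aut k w))

    forest-aut : ∀ v → forestCore G (⟦ g ⟧ v) ≡ forestCore G v
    forest-aut = removed-aut n

    cyc-aut : ∀ v → inCyc G (⟦ g ⟧ v) ≡ inCyc G v
    cyc-aut = cong not ∘ forest-aut

    inF-aut : ∀ v → inF G (⟦ g ⟧ v) ≡ inF G v
    inF-aut v = cong₂ (λ r d → r ∨ not (d ℕ.≡ᵇ 0)) (forest-aut v) (count-neighbours v forest-aut)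

    edgeF-aut : ∀ v w → edgeF G (⟦ g ⟧ v) (⟦ g ⟧ w) ≡ edgeF G v w
    edgeF-aut v w = cong₂ _∧_ (proj₂ g v w) (cong₂ _∨_ (forest-aut v) (forest-aut w))

  forest⇒inF : ∀ {v} → forestCore G v ≡ true → inF G v ≡ true
  forest⇒inF Fv rewrite Fv = refl

  forest-neighbour⇒inF : ∀ {v w} → adj G v w ≡ true → forestCore G w ≡ true → inF G v ≡ true
  forest-neighbour⇒inF {v} {w} Avw Fw = trans (cong (forestCore G v ∨_) (positive (countTrue-pos w (cong₂ _∧_ Avw Fw))))
    (∨-zeroʳ (forestCore G v))
    where
    positive : ∀ {k} → 1 ℕ.≤ k → not (k ℕ.≡ᵇ 0) ≡ true
    positive (ℕ.s≤s _) = refl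

  forest-or-cyc : ∀ v → forestCore G v ≡ true ⊎ inCyc G v ≡ true
  forest-or-cyc v with forestCore G v
  ... | true  = inj₁ refl
  ... | false = inj₂ refl

-- The kernel of the action on cohomology and the splitting

module Splitting (G : Graph n) (conn : Connected G) (betti≥2 : betti1 G ≥ 2) where

  open Core G conn betti≥2

  private
    F : Fin n → Bool
    F = forestCore G

    cyc⇒¬F : ∀ {v} → inCyc G v ≡ true → F v ≡ false
    cyc⇒¬F {v} Cv with F v
    ... | false = refl

  ker⇒fixes-cyc : ∀ g → InKerφ1 G g → FixesCyc G g
  ker⇒fixes-cyc g ker v Cv = trans (cong ⟦ g ⟧ (≡.sym (γ-fixes v Cv))) (inverseʳ (proj₁ g))
    where
    γ = ⟦ g ⟧⁻¹
    γ-F : ∀ v → F (γ v) ≡ F v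
    γ-F = forest-aut G (inverse-aut G g)
    u : Fin n → Fin n → Fin n → ℚ
    u-D : ∀ x y v w → adj G v w ≡ true → edgeForm x y (γ v) (γ w) - edgeForm x y v w ≡ u x y w - u x y v
    edge : Fin n → Fin n → Ω1 G
    edge x y = edgeForm x y , λ v w _ →
      solve 4 (λ a b c d → a :* b :- c :* d := :- (d :* c :- b :* a)) refl (δ x v) (δ y w) (δ y v) (δ x w)
    u x y   = proj₁ (ker (edge x y))
    u-D x y = proj₂ (ker (edge x y))
    -- The potentials supplied by `ker` for `x y` and `y x` are chosen independently.
    -- Antisymmetrising them keeps the differential, because `edgeForm` is itself antisymmetric in
    -- `x` and `y`.
    c : Fin n → Fin n → Fin n → ℚ
    c x y v = ½ * (u x y v - u y x v)
    c-D : ∀ x y v w → adjOff G F v w ≡ true → c x y w - c x y v ≡ edgeForm x y (γ v) (γ w) - edgeForm x y v w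
    c-D x y v w Evw = begin
      ½ * (u x y w - u y x w) - ½ * (u x y v - u y x v)
        ≡⟨ solve 4 (λ a b c d → con ½ :* (a :- b) :- con ½ :* (c :- d) := con ½ :* ((a :- c) :- (b :- d))) refl
             (u x y w) (u y x w) (u x y v) (u y x v) ⟩
      ½ * ((u x y w - u x y v) - (u y x w - u y x v))
        ≡⟨ cong₂ (λ p q → ½ * (p - q)) (u-D x y v w Avw) (u-D y x v w Avw) ⟨
      ½ * ((edgeForm x y (γ v) (γ w) - edgeForm x y v w) - (edgeForm y x (γ v) (γ w) - edgeForm y x v w))
        ≡⟨ solve 8 (λ a b c d e f g h →
             con ½ :* (((a :* b :- c :* d) :- (e :* f :- g :* h)) :- ((c :* d :- a :* b) :- (g :* h :- e :* f))) :=
             (a :* b :- c :* d) :- (e :* f :- g :* h)) refl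
             (δ x (γ v)) (δ y (γ w)) (δ y (γ v)) (δ x (γ w)) (δ x v) (δ y w) (δ y v) (δ x w) ⟩
      edgeForm x y (γ v) (γ w) - edgeForm x y v w ∎
      where
      open ≡.≡-Reasoning
      Avw = adjOff⇒adj G F Evw
    γ-fixes : ∀ v → inCyc G v ≡ true → γ v ≡ v
    γ-fixes = Lefschetz.fixes-all (adjOff G F) (adjOff-sym G F) (adjOff-irrefl G F) (inCyc G)
      (λ v w Evw → cong not (adjOff⇒source G F Evw))
      (λ v w Cv Cw → connectedOff n v w (cyc⇒¬F Cv) (cyc⇒¬F Cw))
      γ (λ v w → cong₂ _∧_ (proj₂ (inverse-aut G g) v w) (cong₂ (λ r s → not r ∧ not s) (γ-F v) (γ-F w)))
      (cong not ∘ γ-F)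
      c (λ x y v → solve 2 (λ a b → con ½ :* (b :- a) := :- (con ½ :* (a :- b))) refl (u x y v) (u y x v)) c-D
      root (cong not root∈core) (λ v Cv → core-degree≥2 v (cyc⇒¬F Cv)) (excess n)

  -- With `u` a potential of `f` on the forest edges, `u (γ v) - u v` is a potential for the change
  -- of `f`. On a core edge both ends are fixed by `γ`, so both sides vanish.
  fixes-cyc⇒ker : ∀ g → FixesCyc G g → InKerφ1 G g
  fixes-cyc⇒ker g fixes f with forest-potential f
  ... | u , exact = (λ v → u (γ v) - u v) , cobound
    where
    γ = ⟦ g ⟧⁻¹
    γ-fixes : ∀ v → F v ≡ false → γ v ≡ v
    γ-fixes v Fv = trans (cong γ (≡.sym (fixes v (cong not Fv)))) (inverseˡ (proj₁ g))
    on-forest : ∀ v w → edgeF G v w ≡ true →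
      proj₁ f (γ v) (γ w) - proj₁ f v w ≡ (u (γ w) - u w) - (u (γ v) - u v)
    on-forest v w Fvw = trans
      (cong₂ _-_ (exact (γ v) (γ w) (trans (edgeF-aut G (inverse-aut G g) v w) Fvw)) (exact v w Fvw))
      (solve 4 (λ a b c d → (a :- b) :- (c :- d) := (a :- c) :- (b :- d)) refl (u (γ w)) (u (γ v)) (u w) (u v))
    cobound : ∀ v w → adj G v w ≡ true → proj₁ f (γ v) (γ w) - proj₁ f v w ≡ (u (γ w) - u w) - (u (γ v) - u v)
    cobound v w Avw with F v in Fv | F w in Fw
    ... | true  | _    = on-forest v w (cong₂ _∧_ Avw (cong (_∨ F w) Fv))
    ... | false | true = on-forest v w (cong₂ _∧_ Avw (cong₂ _∨_ Fv Fw))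
    ... | false | false rewrite γ-fixes v Fv | γ-fixes w Fw =
      solve 3 (λ f a b → f :- f := (a :- a) :- (b :- b)) refl (proj₁ f v w) (u w) (u v)

  module _ (trivial : H0F-trivial G) where

    -- The indicator of the vertices attached at `v` is constant on the components of F(Γ). Its
    -- invariance under `g` restricted to F(Γ) says that `γ v` is attached at `v`; but `γ v` lies in
    -- the core and is its own attachment vertex.
    attachment-fixed : ∀ g v → inF G v ≡ true → F v ≡ false → ⟦ g ⟧ v ≡ v
    attachment-fixed g v Fv ¬Fv = trans (cong ⟦ g ⟧ (≡.sym γv≡v)) (inverseʳ (proj₁ g))
      where
      σ : Permutation′ n
      σ = restrict (proj₁ g) (inF G) (inF-aut G g)
      σ-aut : IsAutF G σ
      σ-aut = (λ w → restrict-out (proj₁ g) (inF G) (inF-aut G g)) , restrict-preserves (proj₁ g) (inF G) (inF-aut G g) ,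
        λ x y Fx Fy → trans (cong₂ (edgeF G) (restrict-in (proj₁ g) (inF G) (inF-aut G g) Fx)
          (restrict-in (proj₁ g) (inF G) (inF-aut G g) Fy)) (edgeF-aut G g x y)
      u : Fin n → ℚ
      u w = δ (attachment w) v
      δ≡1⇒≡ : ∀ {i j : Fin n} → δ i j ≡ 1ℚ → i ≡ j
      δ≡1⇒≡ {i} {j} eq with i ≟ j
      ... | yes i≡j = i≡j
      γ = ⟦ g ⟧⁻¹
      γv≡v : γ v ≡ v
      γv≡v = begin
        γ v
          ≡⟨ attachment-core (trans (forest-aut G (inverse-aut G g) v) ¬Fv) ⟨
        attachment (γ v)
          ≡⟨ cong attachment (restrict-in⁻¹ (proj₁ g) (inF G) (inF-aut G g) Fv) ⟨
        attachment (σ ⟨$⟩ˡ v)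
          ≡⟨ δ≡1⇒≡ (trans (trivial σ σ-aut u (λ x y Fxy → cong (λ a → δ a v) (attachment-edge x y Fxy)) v Fv)
               (trans (cong (λ a → δ a v) (attachment-core ¬Fv)) (δ-refl v))) ⟩
        v ∎
        where open ≡.≡-Reasoning

    -- An edge between the forest and the core has its core end fixed by every automorphism.
    mixed-adj : ∀ g {v w} → F v ≡ true → F w ≡ false → adj G (⟦ g ⟧ v) w ≡ adj G v w
    mixed-adj g {v} {w} Fv Fw with inF G w in Iw
    ... | true  = trans (cong (adj G (⟦ g ⟧ v)) (≡.sym (attachment-fixed g w Iw Fw))) (proj₂ g v w)
    ... | false = trans (isolated (trans (forest-aut G g v) Fv)) (≡.sym (isolated Fv))
      where
      isolated : ∀ {v} → F v ≡ true → adj G v w ≡ false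
      isolated {v} Fv = Bool.¬-not λ Avw → contradiction
        (trans (≡.sym Iw) (forest-neighbour⇒inF G (trans (Graph.sym G w v) Avw) Fv)) λ ()

    forest-part : Aut G → Aut G
    forest-part g = restrict (proj₁ g) F (forest-aut G g) , preserves
      where
      preserves : IsAut G (restrict (proj₁ g) F (forest-aut G g))
      preserves v w with F v in Fv | F w in Fw
      ... | true  | true  = proj₂ g v w
      ... | true  | false = mixed-adj g Fv Fw
      ... | false | true  = trans (Graph.sym G v (⟦ g ⟧ w)) (trans (mixed-adj g Fw Fv) (Graph.sym G w v))
      ... | false | false = refl

    cyc-part : Aut G → Aut G
    cyc-part g = restrict (proj₁ g) (inCyc G) (cyc-aut G g) , preserves
      where
      mixed : ∀ {v w} → F v ≡ true → F w ≡ false → adj G v (⟦ g ⟧ w) ≡ adj G v w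
      -- `mixed-adj` is applied at the core vertex `⟦ g ⟧ w`: it allows `v` to be replaced by
      -- `⟦ g ⟧ v`, after which `g` can be cancelled from both ends.
      mixed {v} {w} Fv Fw = trans (≡.sym (mixed-adj g Fv (trans (forest-aut G g w) Fw))) (proj₂ g v w)
      preserves : IsAut G (restrict (proj₁ g) (inCyc G) (cyc-aut G g))
      preserves v w with F v in Fv | F w in Fw
      ... | true  | true  = refl
      ... | true  | false = mixed Fv Fw
      ... | false | true  = trans (Graph.sym G (⟦ g ⟧ v) w) (trans (mixed Fw Fv) (Graph.sym G w v))
      ... | false | false = proj₂ g v w

    forest-part-fixes : ∀ g → FixesCyc G (forest-part g)
    forest-part-fixes g v Cv = restrict-out (proj₁ g) F (forest-aut G g) (cyc⇒¬F Cv)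

    cyc-part-fixes : ∀ g → FixesF G (cyc-part g)
    cyc-part-fixes g v Iv with F v in Fv
    ... | true  = refl
    ... | false = attachment-fixed g v (trans (cong (_∨ anyFin (λ w → adj G v w ∧ F w)) Fv) Iv) Fv

    factor : ∀ g v → ⟦ g ⟧ v ≡ ⟦ forest-part g ⟧ (⟦ cyc-part g ⟧ v)
    factor g v with forest-or-cyc G v
    ... | inj₁ Fv = ≡.sym (trans (cong ⟦ forest-part g ⟧ (cyc-part-fixes g v (forest⇒inF G Fv)))
      (restrict-in (proj₁ g) F (forest-aut G g) Fv))
    ... | inj₂ Cv = ≡.sym (trans (cong ⟦ forest-part g ⟧ (restrict-in (proj₁ g) (inCyc G) (cyc-aut G g) Cv))
      (forest-part-fixes g (⟦ g ⟧ v) (trans (cyc-aut G g v) Cv)))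

    -- Write `g` as `k` after `l`. Then `φ1 g f` is `φ1 k` applied to `φ1 l f`, and `k` acts
    -- trivially on cohomology since it fixes the core. The sign of the potential changes because
    -- the two forms are compared in the opposite order.
    cyc-part-φ1 : ∀ g → Sameφ1 G (cyc-part g) g
    cyc-part-φ1 g f with fixes-cyc⇒ker (forest-part g) (forest-part-fixes g) (pullback f)
      where
      pullback : Ω1 G → Ω1 G
      pullback (f , f-anti) = φ1 {G = G} (cyc-part g) f , λ v w Avw → f-anti _ _ (trans (proj₂ (inverse-aut G (cyc-part g)) v w) Avw)
    ... | u , exact = (λ v → - u v) , λ v w Avw → trans
      (cong (λ z → φ1 {G = G} l (proj₁ f) v w - z) (cong₂ (proj₁ f) (γ-factor v) (γ-factor w)))
      (trans (solve 2 (λ a b → a :- b := :- (b :- a)) refl (φ1 {G = G} l (proj₁ f) v w) (φ1 {G = G} k (φ1 {G = G} l (proj₁ f)) v w))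
        (trans (cong -_ (exact v w Avw)) (solve 2 (λ a b → :- (a :- b) := :- a :- :- b) refl (u w) (u v))))
      where
      k = forest-part g
      l = cyc-part g
      γ-factor : ∀ v → ⟦ g ⟧⁻¹ v ≡ ⟦ l ⟧⁻¹ (⟦ k ⟧⁻¹ v)
      γ-factor v = begin
        ⟦ g ⟧⁻¹ v
          ≡⟨ cong ⟦ g ⟧⁻¹ (trans (cong ⟦ k ⟧ (inverseʳ (proj₁ l))) (inverseʳ (proj₁ k))) ⟨
        ⟦ g ⟧⁻¹ (⟦ k ⟧ (⟦ l ⟧ (⟦ l ⟧⁻¹ (⟦ k ⟧⁻¹ v))))
          ≡⟨ cong ⟦ g ⟧⁻¹ (factor g _) ⟨
        ⟦ g ⟧⁻¹ (⟦ g ⟧ (⟦ l ⟧⁻¹ (⟦ k ⟧⁻¹ v)))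
          ≡⟨ inverseˡ (proj₁ g) ⟩
        ⟦ l ⟧⁻¹ (⟦ k ⟧⁻¹ v) ∎
        where open ≡.≡-Reasoning

  -- The composite `h` of `l'` with the inverse of `l` acts trivially on cohomology, so it fixes the
  -- core; it fixes the forest because both factors do.
  φ1-injective : ∀ l l' → FixesF G l → FixesF G l' → Sameφ1 G l l' → l ≈A l'
  φ1-injective l l' lF l'F same v = begin
    ⟦ l ⟧ v                      ≡⟨ h-fixes (⟦ l ⟧ v) ⟨
    ⟦ l' ⟧ (⟦ l ⟧⁻¹ (⟦ l ⟧ v))   ≡⟨ cong ⟦ l' ⟧ (inverseˡ (proj₁ l)) ⟩
    ⟦ l' ⟧ v                     ∎
    where
    open ≡.≡-Reasoning
    _∘G_ = _∘A_ G
    h : Aut G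
    h = l' ∘G inverse-aut G l
    h-ker : InKerφ1 G h
    -- The hypothesis is applied to `f` pulled back along `l`: `φ1 l` turns this back into `f`, and
    -- `φ1 l'` turns it into `φ1 h f`.
    h-ker (f , f-anti) with same ((λ v w → f (⟦ l ⟧ v) (⟦ l ⟧ w)) , λ v w Avw → f-anti _ _ (trans (proj₂ l v w) Avw))
    ... | u , exact = (λ v → - u v) , λ v w Avw → begin
      φ1 {G = G} h f v w - f v w
        ≡⟨ cong (_-_ (φ1 {G = G} h f v w)) (cong₂ f (inverseʳ (proj₁ l)) (inverseʳ (proj₁ l))) ⟨
      φ1 {G = G} h f v w - f (⟦ l ⟧ (⟦ l ⟧⁻¹ v)) (⟦ l ⟧ (⟦ l ⟧⁻¹ w))
        ≡⟨ solve 2 (λ a b → a :- b := :- (b :- a)) refl (φ1 {G = G} h f v w) (f (⟦ l ⟧ (⟦ l ⟧⁻¹ v)) (⟦ l ⟧ (⟦ l ⟧⁻¹ w))) ⟩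
      - (f (⟦ l ⟧ (⟦ l ⟧⁻¹ v)) (⟦ l ⟧ (⟦ l ⟧⁻¹ w)) - φ1 {G = G} h f v w)
        ≡⟨ cong -_ (exact v w Avw) ⟩
      - (u w - u v)
        ≡⟨ solve 2 (λ a b → :- (a :- b) := :- a :- :- b) refl (u w) (u v) ⟩
      - u w - - u v ∎
    h-fixes : ∀ v → ⟦ h ⟧ v ≡ v
    h-fixes v with forest-or-cyc G v
    ... | inj₂ Cv = ker⇒fixes-cyc h h-ker v Cv
    ... | inj₁ Fv = trans (cong ⟦ l' ⟧ (trans (cong ⟦ l ⟧⁻¹ (≡.sym (lF v Iv))) (inverseˡ (proj₁ l)))) (l'F v Iv)
      where Iv = forest⇒inF G Fv

  commute : ∀ k l → FixesCyc G k → FixesF G l → ∀ v → ⟦ k ⟧ (⟦ l ⟧ v) ≡ ⟦ l ⟧ (⟦ k ⟧ v)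
  commute k l kC lF v with forest-or-cyc G v
  ... | inj₁ Fv = trans (cong ⟦ k ⟧ (lF v (forest⇒inF G Fv))) (≡.sym (lF (⟦ k ⟧ v) (forest⇒inF G (trans (forest-aut G k v) Fv))))
  ... | inj₂ Cv = trans (kC (⟦ l ⟧ v) (trans (cyc-aut G l v) Cv)) (cong ⟦ l ⟧ (≡.sym (kC v Cv)))

  -- On the forest `l` and `l'` are the identity, so the products determine `k`. On the core, which
  -- `l` and `l'` preserve, `k` and `k'` are the identity and the products determine `l`.
  factors-unique : ∀ k l k' l' → FixesCyc G k → FixesF G l → FixesCyc G k' → FixesF G l' →
    (∀ v → ⟦ k ⟧ (⟦ l ⟧ v) ≡ ⟦ k' ⟧ (⟦ l' ⟧ v)) → ∀ v → ⟦ k ⟧ v ≡ ⟦ k' ⟧ v P.× ⟦ l ⟧ v ≡ ⟦ l' ⟧ v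
  factors-unique k l k' l' kC lF k'C l'F eq v with forest-or-cyc G v
  ... | inj₁ Fv = trans (cong ⟦ k ⟧ (≡.sym (lF v Iv))) (trans (eq v) (cong ⟦ k' ⟧ (l'F v Iv))) , trans (lF v Iv) (≡.sym (l'F v Iv))
    where Iv = forest⇒inF G Fv
  ... | inj₂ Cv = trans (kC v Cv) (≡.sym (k'C v Cv)) ,
    trans (≡.sym (kC (⟦ l ⟧ v) (trans (cyc-aut G l v) Cv))) (trans (eq v) (k'C (⟦ l' ⟧ v) (trans (cyc-aut G l' v) Cv)))

theorem3p15 : ∀ {n} (G : Graph n) → Connected G → betti1 G ≥ 2 →
    H0F-trivial G → AutSplitting G
theorem3p15 G conn betti≥2 trivial = record
  { ker-iff-fixCyc   = λ g → ker⇒fixes-cyc g , fixes-cyc⇒ker g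
  ; φ1-inj-on-L      = φ1-injective
  ; φ1-onto-on-L     = λ g → cyc-part trivial g , cyc-part-fixes trivial g , cyc-part-φ1 trivial g
  ; K-L-commute      = commute
  ; decompose        = λ g → forest-part trivial g , cyc-part trivial g ,
      forest-part-fixes trivial g , cyc-part-fixes trivial g , factor trivial g
  ; decompose-unique = λ k l k' l' kC lF k'C l'F eq →
      let unique = factors-unique k l k' l' kC lF k'C l'F eq in proj₁ ∘ unique , proj₂ ∘ unique
  }
  where open Splitting G conn betti≥2
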